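{- Let $\Gamma=(S,R)$ be a finite simple connected graph which is nondegenerate but is not the line graph of any simple graph. Then $\Gamma$ is $2$-lit. Moreover, the following are equivalent: (i) $\Gamma$ is $1$-lit; (ii) the restriction of $Q$ to the set $\{\alpha_s^\vee\mid s\in S\}$ is surjective onto $\mathbb{F}_2$.
   Context: Let $V$ be the $\mathbb{F}_2$-vector space with basis $\{\alpha_s\mid s\in S\}$, and let $V^\ast$ be its dual space with dual basis $\{f_s\mid s\in S\}$, so $f_s(\alpha_t)=\delta_{st}$. Let $B$ be the bilinear form on $V$ with $B(\alpha_s,\alpha_t)=1$ if $st\in R$ and $0$ otherwise. $\Gamma$ is nondegenerate if $B$ is nondegenerate, equivalently if the adjacency matrix of $\Gamma$ over $\mathbb{F}_2$ is invertible. When $B$ is nondegenerate, $\{\alpha_s^\vee\mid s\in S\}$ denotes the basis of $V$ dual to $\{\alpha_s\}$ with respect to $B$, i.e. $B(\alpha_s^\vee,\alpha_t)=\delta_{st}$ for all $s,t\in S$. Let $Q:V\to\mathbb{F}_2$ be the unique quadratic form with $Q(\alpha+\beta)=Q(\alpha)+Q(\beta)+B(\alpha,\beta)$ for all $\alpha,\beta$ and $Q(\alpha_s)=1$ for all $s\in S$. Lit-only $\sigma$-game: a configuration is an element $f\in V^\ast$, where vertex $t$ is "on" iff $f(\alpha_t)=1$. For $s\in S$, the move $\kappa_s:V^\ast\to V^\ast$ is $\kappa_s f=f+f(\alpha_s)\sum_{st\in R}f_t$; that is, if $s$ is on, the states of all neighbors of $s$ are toggled. Given an integer $k$, $\Gamma$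 is $k$-lit if for every configuration the number of on vertices can be reduced to at most $k$ by a finite sequence of moves. The line graph of a graph $G$ has the edges of $G$ as vertices, adjacent iff they share an endpoint. -}

module Defs where

open import Data.Nat using (ℕ; zero; suc; _+_; _≤_)
open import Data.Fin using (Fin; zero; suc; _<_; _<?_)
open import Data.Bool using (Bool; true; false; _∧_; _xor_; if_then_else_)
open import Data.Product using (Σ; ∃; _×_; _,_; proj₁; proj₂)
open import Data.Sum using (_⊎_)
open import Relation.Binary.PropositionalEquality using (_≡_; _≢_)
open import Relation.Nullary.Decidable using (⌊_⌋)
open import Function.Bundles using (_⇔_)

record Graph (n : ℕ) : Set where
  field
    adj    : Fin n → Fin n → Bool
    sym    : ∀ s t → adj s t ≡ adj t s
    irrefl : ∀ s → adj s s ≡ false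
open Graph public

Σ₂ : ∀ {n} → (Fin n → Bool) → Bool
Σ₂ {zero}  f = false
Σ₂ {suc n} f = f zero xor Σ₂ (λ i → f (suc i))

weight : ∀ {n} → (Fin n → Bool) → ℕ
weight {zero}  f = 0
weight {suc n} f = (if f zero then 1 else 0) + weight (λ i → f (suc i))

data Walk {n} (Γ : Graph n) : Fin n → Fin n → Set where
  here : ∀ {s} → Walk Γ s s
  next : ∀ {s t u} → adj Γ s t ≡ true → Walk Γ t u → Walk Γ s u

Connected : ∀ {n} → Graph n → Set
Connected Γ = ∀ s t → Walk Γ s t

Vec₂ : ℕ → Set
Vec₂ n = Fin n → Bool

α : ∀ {n} → Fin n → Vec₂ n
α s t = ⌊ s Data.Fin.≟ t ⌋

B : ∀ {n} → Graph n → Vec₂ n → Vec₂ n → Bool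
B Γ v w = Σ₂ (λ s → Σ₂ (λ t → v s ∧ (w t ∧ adj Γ s t)))

Nondegenerate : ∀ {n} → Graph n → Set
Nondegenerate {n} Γ = ∀ (v : Vec₂ n) → (∀ w → B Γ v w ≡ false) → ∀ s → v s ≡ false

-- The quadratic form Q with Q(α_s) = 1 and Q(α+β) = Q(α)+Q(β)+B(α,β):
-- Q(v) = Σ_s v_s + Σ_{s<t} v_s v_t B(α_s,α_t).
Q : ∀ {n} → Graph n → Vec₂ n → Bool
Q Γ v = Σ₂ v xor Σ₂ (λ s → Σ₂ (λ t → ⌊ s <? t ⌋ ∧ (v s ∧ (v t ∧ adj Γ s t))))

IsDualBasis : ∀ {n} → Graph n → (Fin n → Vec₂ n) → Set
IsDualBasis Γ d = ∀ s t → B Γ (d s) (α t) ≡ α s t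

-- Line graphs: Γ is (isomorphic to) the line graph of a simple graph G on Fin m
-- whose edge set is the image of an injective map `ends` from S to 2-subsets {a,b} (a < b)
-- of Fin m, with distinct vertices adjacent iff the corresponding edges share an endpoint.
ShareEndpoint : ∀ {m} → (Fin m × Fin m) → (Fin m × Fin m) → Set
ShareEndpoint (a , b) (c , d) = (a ≡ c) ⊎ (a ≡ d) ⊎ (b ≡ c) ⊎ (b ≡ d)

IsLineGraph : ∀ {n} → Graph n → Set
IsLineGraph {n} Γ =
  Σ ℕ λ m → Σ (Fin n → Fin m × Fin m) λ ends →
      (∀ s → proj₁ (ends s) < proj₂ (ends s))
    × (∀ s t → ends s ≡ ends t → s ≡ t)
    × (∀ s t → s ≢ t → (adj Γ s t ≡ true ⇔ ShareEndpoint (ends s) (ends t)))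

-- Lit-only σ-game. Configurations f ∈ V* are given by their values f(α_t).
Config : ℕ → Set
Config n = Fin n → Bool

κ : ∀ {n} → Graph n → Fin n → Config n → Config n
κ Γ s f t = f t xor (f s ∧ adj Γ s t)

data Reach {n} (Γ : Graph n) : Config n → Config n → Set where
  done : ∀ {f} → Reach Γ f f
  move : ∀ {f g} (s : Fin n) → Reach Γ (κ Γ s f) g → Reach Γ f g

_-lit : ℕ → ∀ {n} → Graph n → Set
(k -lit) {n} Γ = ∀ (f : Config n) → Σ (Config n) λ g → Reach Γ f g × weight g ≤ k

{-# OPTIONS --safe #-}

-- Identify a configuration f with the vector v such that f = B(v , -). A move at s becomes the transvection v ↦ v + B(v , α_s) α_s,
-- and the theorem amounts to: the group W of these transvections is transitive on the nonzero vectors of each Q-value.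
-- Indeed the dual basis vectors and their pairwise sums take both values, unless Γ is complete.
--
-- Let Δ be the W-orbit of the α_s; u + v ∈ Δ whenever u, v ∈ Δ and B(u , v) = 1. If u + v + w ∈ Δ for all pairwise
-- orthogonal u, v, w ∈ Δ, then reducing sums of elements of Δ gives Δ = {Q = 1}, and transitivity follows.
-- Otherwise no element of Δ is nonorthogonal to all three of some bad triple u, v, w. This triple spreads out to six points
-- whose transpositions (12), (34), (56) are u, v, w; in a maximal extension of this system of points every element of Δ
-- separates exactly two points from the rest, and nondegeneracy forces it to be their transposition. Then Γ is a line graph.
module Submission where

open import Defs
open import Data.Bool using (Bool; true; false; not; _∧_; _xor_; if_then_else_)
open import Data.Bool.Properties using (xor-same; xor-identityʳ; xor-comm; xor-assoc; ∧-comm; ∧-zeroʳ; ∧-identityʳ; ¬-not) renaming (_≟_ to _≟ᵇ_)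
open import Data.Bool.Solver using (module xor-∧-Solver)
open import Data.Empty using (⊥; ⊥-elim)
open import Data.Fin as Fin using (Fin; zero; suc; _<?_; funToFin; finToFun; toℕ; punchIn; punchOut)
open import Data.Fin.Properties using (any?; all?; suc-injective; 2↔Bool; finToFun-funToFin; funToFin-finToFin; <-cmp; <⇒≢; punchOut-injective; punchIn-injective; punchIn-punchOut; punchInᵢ≢i; injective⇒≤; pigeonhole; toℕ<n; toℕ-fromℕ<)
open import Data.List using (List; []; _∷_; _++_; length; take; drop)
open import Data.List.Properties using (length-++; length-take; length-drop; take++drop≡id)
open import Data.Nat as ℕ using (ℕ; zero; suc; _^_; _+_; _≤_; z≤n; s≤s)
import Data.Nat.Properties as ℕ
open import Data.Product using (Σ; ∃; _×_; _,_; proj₁; proj₂)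
open import Data.Sum using (_⊎_; inj₁; inj₂)
open import Function using (_∘_)
open import Function.Bundles using (_⇔_; mk⇔; Inverse)
open import Relation.Binary using (tri<; tri≈; tri>)
open import Relation.Binary.PropositionalEquality using (_≡_; _≢_; refl; trans; cong; cong₂; subst; _≗_; module ≡-Reasoning) renaming (sym to ≡-sym)
open import Relation.Nullary using (¬_; Dec; yes; no; contradiction)
open import Relation.Nullary.Decidable using (⌊_⌋; isYes≗does; dec-true; dec-false; map′; _⊎-dec_; _×-dec_; ¬?)

open xor-∧-Solver using (solve; _:+_; _:*_; _:=_; con)

-- Unit vectors and sums over the field with two elements.

true≢false : true ≢ false
true≢false ()

α-refl : ∀ {n} (s : Fin n) → α s s ≡ true
α-refl s = trans (isYes≗does (s Fin.≟ s)) (dec-true (s Fin.≟ s) refl)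

α-≢ : ∀ {n} {s t : Fin n} → s ≢ t → α s t ≡ false
α-≢ {s = s} {t} s≢t = trans (isYes≗does (s Fin.≟ t)) (dec-false (s Fin.≟ t) s≢t)

α-true : ∀ {n} (s t : Fin n) → α s t ≡ true → s ≡ t
α-true s t eq with s Fin.≟ t
... | yes s≡t = s≡t
... | no _ = contradiction (≡-sym eq) true≢false

α-sym : ∀ {n} (s t : Fin n) → α s t ≡ α t s
α-sym s t with s Fin.≟ t
... | yes refl = ≡-sym (α-refl s)
... | no s≢t = ≡-sym (α-≢ (s≢t ∘ ≡-sym))

α-suc : ∀ {n} (s t : Fin n) → α (suc s) (suc t) ≡ α s t
α-suc s t = trans (isYes≗does (suc s Fin.≟ suc t)) (≡-sym (isYes≗does (s Fin.≟ t)))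

α-punchIn : ∀ {n} {i j : Fin (suc n)} (j≢i : j ≢ i) k → α i (punchIn j k) ≡ α (punchOut j≢i) k
α-punchIn {i = i} {j} j≢i k with i Fin.≟ punchIn j k | punchOut j≢i Fin.≟ k
... | yes _ | yes _ = refl
... | no _ | no _ = refl
... | yes e | no ne = contradiction (punchIn-injective j _ _ (trans (punchIn-punchOut j≢i) e)) ne
... | no ne | yes e = contradiction (trans (≡-sym (punchIn-punchOut j≢i)) (cong (punchIn j) e)) ne

-- Sums over F₂

Σ₂-cong : ∀ {n} {f g : Fin n → Bool} → f ≗ g → Σ₂ f ≡ Σ₂ g
Σ₂-cong {zero} eq = refl
Σ₂-cong {suc n} eq = cong₂ _xor_ (eq zero) (Σ₂-cong (eq ∘ suc))

Σ₂-xor : ∀ {n} (f g : Fin n → Bool) → Σ₂ (λ i → f i xor g i) ≡ Σ₂ f xor Σ₂ g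
Σ₂-xor {zero} f g = refl
Σ₂-xor {suc n} f g = trans (cong ((f zero xor g zero) xor_) (Σ₂-xor (f ∘ suc) (g ∘ suc)))
  (solve 4 (λ a b c d → (a :+ b) :+ (c :+ d) := (a :+ c) :+ (b :+ d)) refl (f zero) (g zero) (Σ₂ (f ∘ suc)) (Σ₂ (g ∘ suc)))

Σ₂-false : ∀ n → Σ₂ {n} (λ _ → false) ≡ false
Σ₂-false zero = refl
Σ₂-false (suc n) = Σ₂-false n

Σ₂-zero : ∀ {n} {f : Fin n → Bool} → (∀ i → f i ≡ false) → Σ₂ f ≡ false
Σ₂-zero {n} eq = trans (Σ₂-cong eq) (Σ₂-false n)

Σ₂-∧ : ∀ {n} a (f : Fin n → Bool) → Σ₂ (λ i → a ∧ f i) ≡ a ∧ Σ₂ f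
Σ₂-∧ {n} false f = Σ₂-false n
Σ₂-∧ true f = refl

Σ₂-swap : ∀ {m n} (f : Fin m → Fin n → Bool) → Σ₂ (λ i → Σ₂ (λ j → f i j)) ≡ Σ₂ (λ j → Σ₂ (λ i → f i j))
Σ₂-swap {zero} {n} f = ≡-sym (Σ₂-false n)
Σ₂-swap {suc m} f = trans (cong (Σ₂ (f zero) xor_) (Σ₂-swap (f ∘ suc))) (≡-sym (Σ₂-xor (f zero) (λ j → Σ₂ (λ i → f (suc i) j))))

Σ₂-pick : ∀ {n} (s : Fin n) (f : Fin n → Bool) → Σ₂ (λ t → α s t ∧ f t) ≡ f s
Σ₂-pick {suc n} zero f = trans (cong (f zero xor_) (Σ₂-false n)) (xor-identityʳ (f zero))
Σ₂-pick {suc n} (suc s) f = trans (Σ₂-cong (λ t → cong (_∧ f (suc t)) (α-suc s t))) (Σ₂-pick s (f ∘ suc))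

Σ₂-α : ∀ {n} (s : Fin n) → Σ₂ (α s) ≡ true
Σ₂-α s = trans (Σ₂-cong (λ t → ≡-sym (∧-identityʳ (α s t)))) (Σ₂-pick s (λ _ → true))

infixl 6 _⊕_
_⊕_ : ∀ {n} → Vec₂ n → Vec₂ n → Vec₂ n
(u ⊕ v) t = u t xor v t

𝟘 : ∀ {n} → Vec₂ n
𝟘 t = false

≗-sym : ∀ {n} {u v : Vec₂ n} → u ≗ v → v ≗ u
≗-sym e t = ≡-sym (e t)

≗-trans : ∀ {n} {u v w : Vec₂ n} → u ≗ v → v ≗ w → u ≗ w
≗-trans e e′ t = trans (e t) (e′ t)

⊕-cong : ∀ {n} {u u′ v v′ : Vec₂ n} → u ≗ u′ → v ≗ v′ → u ⊕ v ≗ u′ ⊕ v′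
⊕-cong e e′ t = cong₂ _xor_ (e t) (e′ t)

⊕-comm : ∀ {n} (u v : Vec₂ n) → u ⊕ v ≗ v ⊕ u
⊕-comm u v t = xor-comm (u t) (v t)

⊕-assoc : ∀ {n} (u v w : Vec₂ n) → u ⊕ v ⊕ w ≗ u ⊕ (v ⊕ w)
⊕-assoc u v w t = xor-assoc (u t) (v t) (w t)

⊕-cancelʳ : ∀ {n} (u v : Vec₂ n) → u ⊕ v ⊕ v ≗ u
⊕-cancelʳ u v t = solve 2 (λ a b → (a :+ b) :+ b := a) refl (u t) (v t)

⊕-cancelˡ : ∀ {n} (u v : Vec₂ n) → u ⊕ v ⊕ u ≗ v
⊕-cancelˡ u v t = solve 2 (λ a b → (a :+ b) :+ a := b) refl (u t) (v t)

⊕-≗𝟘 : ∀ {n} {u v : Vec₂ n} → u ⊕ v ≗ 𝟘 → u ≗ v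
⊕-≗𝟘 {u = u} {v} e t = trans (solve 2 (λ a b → a := (a :+ b) :+ b) refl (u t) (v t)) (cong (_xor v t) (e t))

-- Every vector is the combination of the `α s` with its own coordinates as coefficients. The
-- induction is on the number `k` of terms, listed by an arbitrary `h`, so that dropping a term
-- keeps the ambient space.
span-ind : ∀ {n} (P : Vec₂ n → Set) → (∀ {u v} → u ≗ v → P u → P v) → P 𝟘 →
  (∀ v s → P v → P (v ⊕ α s)) → ∀ v → P v
span-ind {n} P resp p0 p+ v = resp (λ t → trans (Σ₂-cong (λ s → trans (∧-comm (v s) (α s t)) (cong (_∧ v s) (α-sym s t)))) (Σ₂-pick t v)) (go n (λ s → s) v)
  where
  comb : ∀ k → (Fin k → Fin n) → (Fin k → Bool) → Vec₂ n
  comb k h c t = Σ₂ (λ i → c i ∧ α (h i) t)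
  go : ∀ k (h : Fin k → Fin n) (c : Fin k → Bool) → P (comb k h c)
  go zero h c = resp (λ _ → refl) p0
  go (suc k) h c with c zero
  ... | true = resp (λ t → xor-comm (comb k (h ∘ suc) (c ∘ suc) t) (α (h zero) t)) (p+ _ (h zero) (go k (h ∘ suc) (c ∘ suc)))
  ... | false = go k (h ∘ suc) (c ∘ suc)

≗𝟘? : ∀ {n} (v : Vec₂ n) → Dec (v ≗ 𝟘)
≗𝟘? v = all? (λ s → v s ≟ᵇ false)

-- Encoding vectors as numbers

encode : ∀ {n} → Vec₂ n → Fin (2 ^ n)
encode v = funToFin (Inverse.from 2↔Bool ∘ v)

decode : ∀ {n} → Fin (2 ^ n) → Vec₂ n
decode k = Inverse.to 2↔Bool ∘ finToFun k

decode-encode : ∀ {n} (v : Vec₂ n) → decode (encode v) ≗ v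
decode-encode v t = trans (cong (Inverse.to 2↔Bool) (finToFun-funToFin (Inverse.from 2↔Bool ∘ v) t)) (Inverse.strictlyInverseˡ 2↔Bool (v t))

encode-injective : ∀ {n} {u v : Vec₂ n} → encode u ≡ encode v → u ≗ v
encode-injective {u = u} {v} eq t = trans (≡-sym (decode-encode u t)) (trans (cong (λ k → decode k t) eq) (decode-encode v t))

funToFin-cong : ∀ {m n} {f g : Fin m → Fin n} → f ≗ g → funToFin f ≡ funToFin g
funToFin-cong {zero} eq = refl
funToFin-cong {suc m} eq = cong₂ Fin.combine (eq zero) (funToFin-cong (eq ∘ suc))

decode-injective : ∀ {n} {j k : Fin (2 ^ n)} → decode {n} j ≗ decode k → j ≡ k
decode-injective {n} {j} {k} eq = trans (≡-sym (funToFin-finToFin {n} j)) (trans (funToFin-cong (λ t → from-inj (eq t))) (funToFin-finToFin {n} k))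
  where
  from-inj : ∀ {a b : Fin 2} → Inverse.to 2↔Bool a ≡ Inverse.to 2↔Bool b → a ≡ b
  from-inj {a} {b} e = trans (≡-sym (Inverse.strictlyInverseʳ 2↔Bool a)) (trans (cong (Inverse.from 2↔Bool) e) (Inverse.strictlyInverseʳ 2↔Bool b))

-- If `y` were missed, punching it out would inject `Fin (suc n)` into `Fin n`.
injective⇒surjective : ∀ {n} (f : Fin n → Fin n) → (∀ {i j} → f i ≡ f j → i ≡ j) → ∀ y → ∃ λ x → f x ≡ y
injective⇒surjective {suc n} f inj y with any? (λ x → f x Fin.≟ y)
... | yes p = p
... | no ¬p = contradiction (injective⇒≤ {f = λ x → punchOut (y≢f x)} (λ {i} {j} e → inj (punchOut-injective (y≢f i) (y≢f j) e))) (ℕ.<⇒≱ (ℕ.n<1+n n))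
  where
  y≢f : ∀ x → y ≢ f x
  y≢f x e = ¬p (x , ≡-sym e)

-- The bilinear form and its quadratic form.

module Form {n : ℕ} (Γ : Graph n) where

  private
    term : Vec₂ n → Vec₂ n → Fin n → Fin n → Bool
    term v w s t = v s ∧ (w t ∧ adj Γ s t)

  B-cong : ∀ {u u′ v v′ : Vec₂ n} → u ≗ u′ → v ≗ v′ → B Γ u v ≡ B Γ u′ v′
  B-cong e e′ = Σ₂-cong (λ s → Σ₂-cong (λ t → cong₂ _∧_ (e s) (cong (_∧ adj Γ s t) (e′ t))))

  B-sym : ∀ u v → B Γ u v ≡ B Γ v u
  B-sym u v = trans (Σ₂-swap (term u v)) (Σ₂-cong (λ t → Σ₂-cong (λ s →
    trans (cong (λ a → u s ∧ (v t ∧ a)) (sym Γ s t)) (solve 3 (λ a b c → a :* (b :* c) := b :* (a :* c)) refl (u s) (v t) (adj Γ t s)))))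

  B-⊕ˡ : ∀ u v w → B Γ (u ⊕ v) w ≡ B Γ u w xor B Γ v w
  B-⊕ˡ u v w = trans (Σ₂-cong (λ s → trans (Σ₂-cong (λ t →
      solve 3 (λ a b c → (a :+ b) :* c := a :* c :+ b :* c) refl (u s) (v s) (w t ∧ adj Γ s t)))
      (Σ₂-xor (term u w s) (term v w s))))
    (Σ₂-xor (λ s → Σ₂ (term u w s)) (λ s → Σ₂ (term v w s)))

  B-𝟘 : ∀ w → B Γ 𝟘 w ≡ false
  B-𝟘 w = trans (B-cong {𝟘} {w ⊕ w} (λ t → ≡-sym (xor-same (w t))) (λ _ → refl)) (trans (B-⊕ˡ w w w) (xor-same (B Γ w w)))

  B-expand : ∀ v w → B Γ v w ≡ Σ₂ (λ s → v s ∧ B Γ (α s) w)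
  B-expand v w = Σ₂-cong (λ s → trans (Σ₂-∧ (v s) (λ t → w t ∧ adj Γ s t)) (cong (v s ∧_) (≡-sym (inner s))))
    where
    inner : ∀ s → B Γ (α s) w ≡ Σ₂ (λ t → w t ∧ adj Γ s t)
    inner s = trans (Σ₂-cong (λ s′ → Σ₂-∧ (α s s′) (λ t → w t ∧ adj Γ s′ t))) (Σ₂-pick s (λ s′ → Σ₂ (λ t → w t ∧ adj Γ s′ t)))

  B-αα : ∀ s t → B Γ (α s) (α t) ≡ adj Γ s t
  B-αα s t = trans (Σ₂-cong (λ s′ → Σ₂-∧ (α s s′) (λ t′ → α t t′ ∧ adj Γ s′ t′)))
    (trans (Σ₂-pick s (λ s′ → Σ₂ (λ t′ → α t t′ ∧ adj Γ s′ t′))) (Σ₂-pick t (adj Γ s)))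

  private
    -- The bilinear form of the strictly upper triangular part of the adjacency matrix. Its diagonal
    -- `half v v` is the quadratic part of `Q Γ v`, so polarising `Q` leaves
    -- `half u v xor half v u`, which is `B Γ u v`.
    half : Vec₂ n → Vec₂ n → Bool
    half v w = Σ₂ (λ s → Σ₂ (λ t → ⌊ s <? t ⌋ ∧ (v s ∧ (w t ∧ adj Γ s t))))

    half-⊕ : ∀ u v u′ v′ → half (u ⊕ v) (u′ ⊕ v′) ≡ (half u u′ xor half v v′) xor (half u v′ xor half v u′)
    half-⊕ u v u′ v′ = trans (Σ₂-cong (λ s → trans (Σ₂-cong (λ t → 
        solve 6 (λ l a b c d e → l :* ((a :+ b) :* ((c :+ d) :* e)) := (l :* (a :* (c :* e)) :+ l :* (b :* (d :* e))) :+ (l :* (a :* (d :* e)) :+ l :* (b :* (c :* e)))) refl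
          ⌊ s <? t ⌋ (u s) (v s) (u′ t) (v′ t) (adj Γ s t)))
        (four (λ t → h u u′ s t) (λ t → h v v′ s t) (λ t → h u v′ s t) (λ t → h v u′ s t))))
      (four (λ s → Σ₂ (h u u′ s)) (λ s → Σ₂ (h v v′ s)) (λ s → Σ₂ (h u v′ s)) (λ s → Σ₂ (h v u′ s)))
      where
      h : Vec₂ n → Vec₂ n → Fin n → Fin n → Bool
      h v w s t = ⌊ s <? t ⌋ ∧ (v s ∧ (w t ∧ adj Γ s t))
      four : (a b c d : Fin n → Bool) → Σ₂ (λ i → (a i xor b i) xor (c i xor d i)) ≡ (Σ₂ a xor Σ₂ b) xor (Σ₂ c xor Σ₂ d)
      four a b c d = trans (Σ₂-xor (λ i → a i xor b i) (λ i → c i xor d i)) (cong₂ _xor_ (Σ₂-xor a b) (Σ₂-xor c d))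

    <?-split : ∀ s t → adj Γ s t ≡ (⌊ s <? t ⌋ ∧ adj Γ s t) xor (⌊ t <? s ⌋ ∧ adj Γ s t)
    <?-split s t with <-cmp s t
    ... | tri< a _ c rewrite isYes≗does (s <? t) | isYes≗does (t <? s) | dec-true (s <? t) a | dec-false (t <? s) c = ≡-sym (xor-identityʳ _)
    ... | tri> a _ c rewrite isYes≗does (s <? t) | isYes≗does (t <? s) | dec-false (s <? t) a | dec-true (t <? s) c = refl
    ... | tri≈ _ refl _ rewrite irrefl Γ s = ≡-sym (cong₂ _xor_ (∧-zeroʳ ⌊ s <? s ⌋) (∧-zeroʳ ⌊ s <? s ⌋))

    half-B : ∀ u v → B Γ u v ≡ half u v xor half v u
    half-B u v = begin
      B Γ u v
        ≡⟨ Σ₂-cong (λ s → Σ₂-cong (λ t → trans (cong (λ a → u s ∧ (v t ∧ a)) (<?-split s t))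
             (solve 5 (λ a b c k l → a :* (b :* (k :* c :+ l :* c)) := k :* (a :* (b :* c)) :+ l :* (a :* (b :* c))) refl (u s) (v t) (adj Γ s t) ⌊ s <? t ⌋ ⌊ t <? s ⌋))) ⟩
      Σ₂ (λ s → Σ₂ (λ t → h s t xor h′ s t))
        ≡⟨ Σ₂-cong (λ s → Σ₂-xor (h s) (h′ s)) ⟩
      Σ₂ (λ s → Σ₂ (h s) xor Σ₂ (h′ s))
        ≡⟨ Σ₂-xor (λ s → Σ₂ (h s)) (λ s → Σ₂ (h′ s)) ⟩
      half u v xor Σ₂ (λ s → Σ₂ (h′ s))
        ≡⟨ cong (half u v xor_) (trans (Σ₂-swap h′) (Σ₂-cong (λ t → Σ₂-cong (λ s → cong (⌊ t <? s ⌋ ∧_)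
             (trans (cong (λ a → u s ∧ (v t ∧ a)) (sym Γ s t)) (solve 3 (λ a b c → a :* (b :* c) := b :* (a :* c)) refl (u s) (v t) (adj Γ t s))))))) ⟩
      half u v xor half v u ∎
      where
      open ≡-Reasoning
      h h′ : Fin n → Fin n → Bool
      h s t = ⌊ s <? t ⌋ ∧ (u s ∧ (v t ∧ adj Γ s t))
      h′ s t = ⌊ t <? s ⌋ ∧ (u s ∧ (v t ∧ adj Γ s t))

  Q-⊕ : ∀ u v → Q Γ (u ⊕ v) ≡ Q Γ u xor Q Γ v xor B Γ u v
  Q-⊕ u v = trans (cong₂ _xor_ (Σ₂-xor u v) (trans (half-⊕ u v u v) (cong ((half u u xor half v v) xor_) (≡-sym (half-B u v)))))
    (solve 5 (λ a b c d e → (a :+ b) :+ ((c :+ d) :+ e) := (a :+ c) :+ ((b :+ d) :+ e)) refl (Σ₂ u) (Σ₂ v) (half u u) (half v v) (B Γ u v))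

  Q-cong : ∀ {u v} → u ≗ v → Q Γ u ≡ Q Γ v
  Q-cong e = cong₂ _xor_ (Σ₂-cong e) (Σ₂-cong (λ s → Σ₂-cong (λ t → cong (⌊ s <? t ⌋ ∧_) (cong₂ _∧_ (e s) (cong (_∧ adj Γ s t) (e t))))))

  Q-α : ∀ s → Q Γ (α s) ≡ true
  Q-α s = cong₂ _xor_
    (Σ₂-α s)
    (Σ₂-zero (λ a → Σ₂-zero (zeroes a)))
    where
    zeroes : ∀ a b → ⌊ a <? b ⌋ ∧ (α s a ∧ (α s b ∧ adj Γ a b)) ≡ false
    zeroes a b with s Fin.≟ a | s Fin.≟ b
    ... | no _ | _ = ∧-zeroʳ ⌊ a <? b ⌋
    ... | yes refl | no _ = ∧-zeroʳ ⌊ a <? b ⌋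
    ... | yes refl | yes refl = trans (cong (⌊ a <? b ⌋ ∧_) (irrefl Γ s)) (∧-zeroʳ ⌊ a <? b ⌋)

  Q-𝟘 : Q Γ 𝟘 ≡ false
  Q-𝟘 = cong₂ _xor_ (Σ₂-false n) (Σ₂-zero {n} (λ s → Σ₂-zero {n} (λ t → ∧-zeroʳ ⌊ s <? t ⌋)))

  B-alt : ∀ v → B Γ v v ≡ false
  B-alt v = trans (solve 2 (λ q b → b := q :+ (q :+ b)) refl (Q Γ v) (B Γ v v))
    (trans (≡-sym (Q-⊕ v v)) (trans (Q-cong (λ t → xor-same (v t))) Q-𝟘))

-- Transvections and their orbits.

module Orbits {n : ℕ} (Γ : Graph n) (connected : Connected Γ) (nondegenerate : Nondegenerate Γ) where

  open Form Γ

  private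
    V : Set
    V = Vec₂ n

  -- Opaque, because unfolding B makes its arguments uninferable.
  opaque
    infix 7 _·_
    _·_ : V → V → Bool
    _·_ = B Γ

    ·-B : ∀ u v → u · v ≡ B Γ u v
    ·-B u v = refl

    ·-⊕ˡ : ∀ {u v w a b} → u · w ≡ a → v · w ≡ b → (u ⊕ v) · w ≡ a xor b
    ·-⊕ˡ {u} {v} {w} p q = trans (B-⊕ˡ u v w) (cong₂ _xor_ p q)

    ·-sym : ∀ {u v a} → u · v ≡ a → v · u ≡ a
    ·-sym {u} {v} p = trans (B-sym v u) p

    ·-respˡ : ∀ {u u′ v a} → u ≗ u′ → u · v ≡ a → u′ · v ≡ a
    ·-respˡ {u} {u′} {v} e p = trans (B-cong {u′} {u} {v} {v} (≗-sym e) (λ _ → refl)) p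

    ·-alt : ∀ v → v · v ≡ false
    ·-alt = B-alt

    ·-αα : ∀ s t → α s · α t ≡ adj Γ s t
    ·-αα = B-αα

    Q-⊕-· : ∀ u v → Q Γ (u ⊕ v) ≡ Q Γ u xor Q Γ v xor u · v
    Q-⊕-· = Q-⊕

    α-separating : ∀ {v} → (∀ s → v · α s ≡ false) → v ≗ 𝟘
    α-separating {v} h = nondegenerate v (λ w → trans (B-sym v w) (trans (B-expand w v)
      (Σ₂-zero (λ s → trans (cong (w s ∧_) (trans (B-sym (α s) v) (h s))) (∧-zeroʳ (w s))))))

  ·-⊕ʳ : ∀ {u v w a b} → u · v ≡ a → u · w ≡ b → u · (v ⊕ w) ≡ a xor b
  ·-⊕ʳ p q = ·-sym (·-⊕ˡ (·-sym p) (·-sym q))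

  𝟘-· : ∀ v → 𝟘 · v ≡ false
  𝟘-· v = trans (·-B 𝟘 v) (B-𝟘 v)

  ·-respʳ : ∀ {u v v′ a} → v ≗ v′ → u · v ≡ a → u · v′ ≡ a
  ·-respʳ e p = ·-sym (·-respˡ e (·-sym p))

  detect : ∀ {v} → ¬ v ≗ 𝟘 → ∃ λ s → v · α s ≡ true
  detect {v} v≢0 with any? (λ s → v · α s ≟ᵇ true)
  ... | yes p = p
  ... | no ¬p = contradiction (α-separating (λ s → ¬-not (λ e → ¬p (s , e)))) v≢0

  values : V → Config n
  values v s = v · α s

  opaque
    -- Counting replaces Gaussian elimination: by nondegeneracy `values` is injective, hence on
    -- encoded vectors an injective self-map of a finite set.
    values-surjective : ∀ f → Σ V λ v → values v ≗ f
    values-surjective f = decode (proj₁ preimage) , encode-injective (proj₂ preimage)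
      where
      inj : ∀ {j k} → encode (values (decode j)) ≡ encode (values (decode k)) → j ≡ k
      inj {j} {k} e = decode-injective {n} (⊕-≗𝟘 (α-separating (λ s →
        trans (·-⊕ˡ {decode j} {decode k} {α s} (encode-injective e s) refl) (xor-same (values (decode k) s)))))
      preimage : ∃ λ k → encode (values (decode k)) ≡ encode f
      preimage = injective⇒surjective (λ k → encode (values (decode k))) inj (encode f)

  infix 4 _⇝_
  -- Only effective transvections count as steps; at `v · α s ≡ false` the vector would stay put.
  data _⇝_ (v w : V) : Set where
    stop : v ≗ w → v ⇝ w
    step : ∀ s → v · α s ≡ true → v ⊕ α s ⇝ w → v ⇝ w

  ⇝-respˡ : ∀ {u v w} → u ≗ v → v ⇝ w → u ⇝ w
  ⇝-respˡ e (stop e′) = stop (≗-trans e e′)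
  ⇝-respˡ e (step s p r) = step s (·-sym (·-respʳ (≗-sym e) (·-sym p))) (⇝-respˡ (⊕-cong e (λ _ → refl)) r)

  ⇝-trans : ∀ {u v w} → u ⇝ v → v ⇝ w → u ⇝ w
  ⇝-trans (stop e) r = ⇝-respˡ e r
  ⇝-trans (step s p r) r′ = step s p (⇝-trans r r′)

  ⇝-respʳ : ∀ {u v w} → v ≗ w → u ⇝ v → u ⇝ w
  ⇝-respʳ e r = ⇝-trans r (stop e)

  ⇝-sym : ∀ {u v} → u ⇝ v → v ⇝ u
  ⇝-sym (stop e) = stop (≗-sym e)
  ⇝-sym {u} (step s p r) = ⇝-trans (⇝-sym r) (step s (·-⊕ˡ p (·-alt (α s))) (stop (⊕-cancelʳ u (α s))))

  ⇝-Q : ∀ {u v} → u ⇝ v → Q Γ u ≡ Q Γ v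
  ⇝-Q (stop e) = Q-cong e
  ⇝-Q {u} (step s p r) = trans (≡-sym (trans (Q-⊕-· u (α s)) (trans (cong₂ (λ a b → Q Γ u xor a xor b) (Q-α s) p) (xor-identityʳ _)))) (⇝-Q r)

  -- These are the real roots of the simply laced root system with diagram `Γ`, reduced modulo 2.
  -- Connectedness makes them a single orbit, see `Δ-transitive`.
  Δ : V → Set
  Δ u = Σ (Fin n) λ s → α s ⇝ u

  Δ-α : ∀ s → Δ (α s)
  Δ-α s = s , stop (λ _ → refl)

  Δ-resp : ∀ {u v} → u ≗ v → Δ u → Δ v
  Δ-resp e (s , r) = s , ⇝-respʳ e r

  Δ-Q : ∀ {u} → Δ u → Q Γ u ≡ true
  Δ-Q (s , r) = trans (≡-sym (⇝-Q r)) (Q-α s)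

  Δ-nonzero : ∀ {u} → Δ u → ¬ u ≗ 𝟘
  Δ-nonzero d e = true≢false (trans (≡-sym (Δ-Q d)) (trans (Q-cong e) Q-𝟘))

  private
    Reflects : V → Set
    Reflects u = ∀ v → v · u ≡ true → v ⇝ v ⊕ u

    -- Conjugating the transvection at `u` by that at `α s` gives the one at `u ⊕ α s`. Of the two
    -- conjugating moves exactly one is effective on `v`: the first if `v · α s` is true, the last
    -- otherwise.
    reflects-step : ∀ {u} s → u · α s ≡ true → Reflects u → Reflects (u ⊕ α s)
    reflects-step {u} s p R v q with v · α s in eq
    ... | true = step s eq (⇝-respʳ (λ t → solve 3 (λ a b c → (a :+ c) :+ b := a :+ (b :+ c)) refl (v t) (u t) (α s t))
                   (R (v ⊕ α s) (·-⊕ˡ (unflip (trans (≡-sym (·-⊕ʳ {v} {u} {α s} refl refl)) q)) (·-sym p))))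
      where
      unflip : ∀ {a} → a xor v · α s ≡ true → a ≡ false
      unflip {a} e rewrite eq = trans (solve 1 (λ a → a := (a :+ con true) :+ con true) refl a) (cong (_xor true) e)
    ... | false = ⇝-trans (R v (unflip (trans (≡-sym (·-⊕ʳ {v} {u} {α s} refl refl)) q)))
                    (step s (·-⊕ˡ eq p) (stop (⊕-assoc v u (α s))))
      where
      unflip : ∀ {a} → a xor v · α s ≡ true → a ≡ true
      unflip {a} e rewrite eq = trans (≡-sym (xor-identityʳ a)) e

    reflects : ∀ {u w} → u ⇝ w → Reflects u → Reflects w
    reflects (stop e) R v p = ⇝-respʳ (⊕-cong {u = v} (λ _ → refl) e) (R v (·-respʳ (≗-sym e) p))
    reflects (step s q r) R = reflects r (reflects-step s q R)

  reflect : ∀ {u} → Δ u → ∀ v → v · u ≡ true → v ⇝ v ⊕ u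
  reflect (s , r) = reflects r (λ v p → step s p (stop (λ _ → refl)))

  Δ-⊕ : ∀ {u v} → Δ u → Δ v → u · v ≡ true → Δ (u ⊕ v)
  Δ-⊕ {u} (s , r) d p = s , ⇝-trans r (reflect d u p)

  -- The transvection at `v ⊕ w` sends `v` to `w`.
  exchange : ∀ {v w} → Δ (v ⊕ w) → v · w ≡ true → v ⇝ w
  exchange {v} {w} d p = ⇝-respʳ (λ t → solve 2 (λ a b → a :+ (a :+ b) := b) refl (v t) (w t)) (reflect d v (·-⊕ʳ (·-alt v) p))

  Δ-transitive : ∀ {u v} → Δ u → Δ v → u ⇝ v
  Δ-transitive (s , r) (t , r′) = ⇝-trans (⇝-sym r) (⇝-trans (walk (connected s t)) r′)
    where
    walk : ∀ {s t} → Walk Γ s t → α s ⇝ α t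
    walk here = stop (λ _ → refl)
    walk (next {s} {t} a w) = ⇝-trans (exchange (Δ-⊕ (Δ-α s) (Δ-α t) p) p) (walk w)
      where
      p : α s · α t ≡ true
      p = trans (·-αα s t) a

  CommonNeighbour : V → V → Set
  CommonNeighbour u v = Σ V λ x → Δ x × x · u ≡ true × x · v ≡ true

  private
    Near : V → V → Set
    Near u v = (u · v ≡ true) ⊎ CommonNeighbour u v

    -- If `α s` and `u` both meet `v`, then `α s` is the new common neighbour; if exactly one does,
    -- `u ⊕ α s` meets `v`. If neither does, the old neighbour `x` survives, corrected by `α s` when
    -- it meets `α s`.
    near-step : ∀ {u v} s → u · α s ≡ true → Near u v → Near (u ⊕ α s) v
    near-step {u} {v} s p near with α s · v in sv | u · v in uv
    ... | true | true = inj₂ (α s , Δ-α s , ·-⊕ʳ (·-sym p) (·-alt (α s)) , sv)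
    ... | true | false = inj₁ (·-⊕ˡ uv sv)
    ... | false | true = inj₁ (·-⊕ˡ uv sv)
    near-step s p (inj₁ ()) | false | false
    near-step {u} {v} s p (inj₂ (x , dx , xu , xv)) | false | false with x · α s in xs
    ... | false = inj₂ (x , dx , ·-⊕ʳ xu xs , xv)
    ... | true = inj₂ (x ⊕ α s , Δ-⊕ dx (Δ-α s) xs , ·-⊕ˡ (·-⊕ʳ xu xs) (·-⊕ʳ (·-sym p) (·-alt (α s))) , ·-⊕ˡ xv sv)

    near : ∀ {u u′ v} → u ⇝ u′ → Near u v → Near u′ v
    near (stop e) (inj₁ p) = inj₁ (·-sym (·-respʳ e (·-sym p)))
    near (stop e) (inj₂ (x , dx , xu , xv)) = inj₂ (x , dx , ·-respʳ e xu , xv)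
    near (step s p r) h = near r (near-step s p h)

  -- By nondegeneracy `v` has a neighbour, trivially common to `v` and `v`. Moving the first copy of
  -- `v` to `u` inside the orbit preserves `Near`.
  common-neighbour : ∀ {u v} → Δ u → Δ v → u · v ≡ false → CommonNeighbour u v
  common-neighbour {u} {v} du dv p with s , q ← detect (Δ-nonzero dv)
    with near (Δ-transitive dv du) (inj₂ (α s , Δ-α s , ·-sym q , ·-sym q))
  ... | inj₁ uv = contradiction (trans (≡-sym uv) p) true≢false
  ... | inj₂ c = c

  -- The double negation allows an argument by contradiction without deciding `Δ`; it is harmless
  -- because being `k`-lit is stable.
  OrthogonalTriplesClosed : Set
  OrthogonalTriplesClosed = ∀ {u v w} → Δ u → Δ v → Δ w →
    u · v ≡ false → u · w ≡ false → v · w ≡ false → ¬ ¬ Δ (u ⊕ v ⊕ w)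

  module Transitivity (closed : OrthogonalTriplesClosed) where

    private
      data Short (v : V) : Set where
        zero : v ≗ 𝟘 → Short v
        one : Δ v → Short v
        two : ∀ {x y} → Δ x → Δ y → x · y ≡ false → v ≗ x ⊕ y → Short v

      Short-resp : ∀ {u v} → u ≗ v → Short u → Short v
      Short-resp e (zero p) = zero (≗-trans (≗-sym e) p)
      Short-resp e (one p) = one (Δ-resp e p)
      Short-resp e (two dx dy o p) = two dx dy o (≗-trans (≗-sym e) p)

      Short-Δ-⊕ : ∀ {u v} → Δ u → Δ v → Short (u ⊕ v)
      Short-Δ-⊕ {u} {v} du dv with u · v in eq
      ... | true = one (Δ-⊕ du dv eq)
      ... | false = two du dv eq (λ _ → refl)

      Short-⊕ : ∀ {v u} → Short v → Δ u → ¬ ¬ Short (v ⊕ u)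
      Short-⊕ (zero p) du k = k (one (Δ-resp (≗-sym (⊕-cong p (λ _ → refl))) du))
      Short-⊕ (one dv) du k = k (Short-Δ-⊕ dv du)
      Short-⊕ {v} {u} (two {x} {y} dx dy o p) du k with x · u in xu | y · u in yu
      ... | true | _ = k (Short-resp (λ t → trans (solve 3 (λ a b c → (a :+ c) :+ b := (a :+ b) :+ c) refl (x t) (y t) (u t)) (cong (_xor u t) (≡-sym (p t)))) (Short-Δ-⊕ (Δ-⊕ dx du xu) dy))
      ... | false | true = k (Short-resp (λ t → trans (≡-sym (xor-assoc (x t) (y t) (u t))) (cong (_xor u t) (≡-sym (p t)))) (Short-Δ-⊕ dx (Δ-⊕ dy du yu)))
      ... | false | false = closed dx dy du o xu yu (λ d → k (one (Δ-resp (⊕-cong (≗-sym p) (λ _ → refl)) d)))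

      short : ∀ v → ¬ ¬ Short v
      short = span-ind (λ v → ¬ ¬ Short v) (λ e ss k → ss (k ∘ Short-resp e)) (λ k → k (zero (λ _ → refl)))
        (λ v s ss k → ss (λ sv → Short-⊕ sv (Δ-α s) k))

    -- Zero and sums of two orthogonal elements of `Δ` have `Q` equal to 0, so of the three short
    -- forms only membership in `Δ` remains.
    Q⇒Δ : ∀ {v} → Q Γ v ≡ true → ¬ ¬ Δ v
    Q⇒Δ {v} q k = short v λ where
      (zero p) → true≢false (trans (≡-sym q) (trans (Q-cong p) Q-𝟘))
      (one d) → k d
      (two {x} {y} dx dy o p) → true≢false (trans (≡-sym q) (trans (Q-cong p) (trans (Q-⊕-· x y)
        (cong₂ _xor_ (Δ-Q dx) (cong₂ _xor_ (Δ-Q dy) o)))))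

    private
      singular-adjacent : ∀ {v w} → Q Γ v ≡ false → Q Γ w ≡ false → v · w ≡ true → ¬ ¬ v ⇝ w
      singular-adjacent {v} {w} qv qw p k =
        Q⇒Δ (trans (Q-⊕-· v w) (cong₂ _xor_ qv (cong₂ _xor_ qw p))) (λ d → k (exchange d p))

      -- Two proper hyperplanes do not cover the space: if neither `α a` nor `α b` serves, their sum
      -- does.
      both : ∀ {v w} → ¬ v ≗ 𝟘 → ¬ w ≗ 𝟘 → Σ V λ z → v · z ≡ true × w · z ≡ true
      both {v} {w} v≢0 w≢0 with a , va ← detect v≢0 | b , wb ← detect w≢0 with w · α a in wa | v · α b in vb
      ... | true | _ = α a , va , wa
      ... | false | true = α b , vb , wb
      ... | false | false = α a ⊕ α b , ·-⊕ʳ va vb , ·-⊕ʳ wa wb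

    -- Singular v and w are connected through a singular z adjacent to both; if Q z = 1, replace z by z + v.
    transitive : ∀ {v w} → ¬ v ≗ 𝟘 → ¬ w ≗ 𝟘 → Q Γ v ≡ Q Γ w → ¬ ¬ v ⇝ w
    transitive {v} {w} v≢0 w≢0 qq k with Q Γ v in qv
    ... | true = Q⇒Δ qv (λ dv → Q⇒Δ (≡-sym qq) (λ dw → k (Δ-transitive dv dw)))
    ... | false with v · w in vw
    ...   | true = singular-adjacent qv (≡-sym qq) vw k
    ...   | false with z , vz , wz ← both v≢0 w≢0 with Q Γ z in qz
    ...     | false = singular-adjacent qv qz vz (λ r → singular-adjacent qz (≡-sym qq) (·-sym wz) (λ r′ → k (⇝-trans r r′)))
    ...     | true = singular-adjacent qv qz′ (·-⊕ʳ vz (·-alt v)) (λ r →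
                       singular-adjacent qz′ (≡-sym qq) (·-sym (·-⊕ʳ wz (·-sym vw))) (λ r′ → k (⇝-trans r r′)))
      where
      qz′ : Q Γ (z ⊕ v) ≡ false
      qz′ = trans (Q-⊕-· z v) (cong₂ _xor_ qz (cong₂ _xor_ qv (·-sym vz)))

-- Vectors of small weight

weight-cong : ∀ {n} {f g : Vec₂ n} → f ≗ g → weight f ≡ weight g
weight-cong {zero} e = refl
weight-cong {suc n} e = cong₂ (λ b k → (if b then 1 else 0) + k) (e zero) (weight-cong (e ∘ suc))

weight-𝟘 : ∀ n → weight {n} 𝟘 ≡ 0
weight-𝟘 zero = refl
weight-𝟘 (suc n) = weight-𝟘 n

weight-not : ∀ {n} (f : Vec₂ n) → weight f + weight (not ∘ f) ≡ n
weight-not {zero} f = refl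
weight-not {suc n} f with f zero
... | true = cong suc (weight-not (f ∘ suc))
... | false = trans (ℕ.+-suc _ _) (cong suc (weight-not (f ∘ suc)))

weight-⊕α : ∀ {n} (f : Vec₂ n) j → f j ≡ false → weight (f ⊕ α j) ≡ suc (weight f)
weight-⊕α {suc n} f zero p rewrite p = cong suc (weight-cong (λ k → xor-identityʳ (f (suc k))))
weight-⊕α {suc n} f (suc j) p = trans
  (cong₂ (λ b k → (if b then 1 else 0) + k) (xor-identityʳ (f zero))
    (trans (weight-cong (λ k → cong (f (suc k) xor_) (α-suc j k))) (weight-⊕α (f ∘ suc) j p)))
  (ℕ.+-suc _ _)

weight-α : ∀ {n} (s : Fin n) → weight (α s) ≡ 1
weight-α {n} s = trans (weight-⊕α 𝟘 s refl) (cong suc (weight-𝟘 n))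

weight-peel : ∀ {n k} (f : Vec₂ n) → weight f ≡ suc k → ∃ λ i → f i ≡ true × weight (f ⊕ α i) ≡ k
weight-peel {n} f p with any? (λ i → f i ≟ᵇ true)
... | yes (i , q) = i , q , ℕ.suc-injective (trans (≡-sym (weight-⊕α (f ⊕ α i) i (cong₂ _xor_ q (α-refl i)))) (trans (weight-cong (⊕-cancelʳ f (α i))) p))
... | no ¬q = contradiction (trans (≡-sym p) (trans (weight-cong (λ i → ¬-not (λ q → ¬q (i , q)))) (weight-𝟘 n))) λ ()

weight≡0 : ∀ {n} (f : Vec₂ n) → weight f ≡ 0 → f ≗ 𝟘
weight≡0 {suc n} f p i with f zero in eq
weight≡0 {suc n} f p zero | false = eq
weight≡0 {suc n} f p (suc i) | false = weight≡0 (f ∘ suc) p i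

weight<⇒false : ∀ {n} (f : Vec₂ n) → weight f ℕ.< n → ∃ λ j → f j ≡ false
weight<⇒false {suc n} f lt with f zero in eq
... | false = zero , eq
... | true with j , p ← weight<⇒false (f ∘ suc) (ℕ.≤-pred lt) = suc j , p

data Small {n : ℕ} (f : Vec₂ n) : Set where
  none : f ≗ 𝟘 → Small f
  one : ∀ i → f ≗ α i → Small f
  two : ∀ i j → i ≢ j → f ≗ α i ⊕ α j → Small f

small : ∀ {n} (f : Vec₂ n) → weight f ≤ 2 → Small f
small f p with weight f in w
... | 0 = none (weight≡0 f w)
... | 1 with i , _ , w′ ← weight-peel f w = one i (⊕-≗𝟘 (weight≡0 _ w′))
... | 2 with i , q , w′ ← weight-peel f w with j , q′ , w″ ← weight-peel _ w′ =
  two i j (λ where refl → true≢false (trans (≡-sym q′) (cong₂ _xor_ q (α-refl i))))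
    (λ t → trans (solve 3 (λ a b c → a := ((a :+ b) :+ c) :+ (b :+ c)) refl (f t) (α i t) (α j t)) (cong (_xor (α i t xor α j t)) (weight≡0 _ w″ t)))
small f (s≤s (s≤s ())) | suc (suc (suc _))

weight-punchIn : ∀ {n} (f : Vec₂ (suc n)) j → weight (f ∘ punchIn j) ≤ weight f
weight-punchIn f zero = ℕ.m≤n+m _ _
weight-punchIn {suc n} f (suc j) = ℕ.+-monoʳ-≤ (if f zero then 1 else 0) (weight-punchIn (f ∘ suc) j)

-- The game graph is finite, hence being k-lit is ¬¬-stable

module Game {n : ℕ} (Γ : Graph n) where

  κ-cong : ∀ s {f g} → f ≗ g → κ Γ s f ≗ κ Γ s g
  κ-cong s e t = cong₂ (λ a b → a xor (b ∧ adj Γ s t)) (e t) (e s)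

  run : List (Fin n) → Config n → Config n
  run [] f = f
  run (s ∷ l) f = run l (κ Γ s f)

  run-cong : ∀ l {f g} → f ≗ g → run l f ≗ run l g
  run-cong [] e = e
  run-cong (s ∷ l) e = run-cong l (κ-cong s e)

  run-++ : ∀ l l′ f → run (l ++ l′) f ≡ run l′ (run l f)
  run-++ [] l′ f = refl
  run-++ (s ∷ l) l′ f = run-++ l l′ (κ Γ s f)

  run-Reach : ∀ l f → Reach Γ f (run l f)
  run-Reach [] f = done
  run-Reach (s ∷ l) f = move s (run-Reach l (κ Γ s f))

  Reach-run : ∀ {f g} → Reach Γ f g → ∃ λ l → run l f ≡ g
  Reach-run done = [] , refl
  Reach-run (move s r) with l , e ← Reach-run r = s ∷ l , e

  -- Among more than `2 ^ n` prefixes two lead to the same configuration, and the loop between them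
  -- can be cut out.
  shorten : ∀ l f → 2 ^ n ℕ.< length l → ∃ λ l′ → length l′ ℕ.< length l × run l′ f ≗ run l f
  shorten l f long with pigeonhole long (λ i → encode (run (take (toℕ i) l) f))
  ... | i , j , i<j , eq = take (toℕ i) l ++ drop (toℕ j) l , shorter , same
    where
    shorter : length (take (toℕ i) l ++ drop (toℕ j) l) ℕ.< length l
    shorter = begin-strict
      length (take (toℕ i) l ++ drop (toℕ j) l) ≡⟨ length-++ (take (toℕ i) l) ⟩
      length (take (toℕ i) l) + length (drop (toℕ j) l) ≡⟨ cong₂ _+_ (length-take (toℕ i) l) (length-drop (toℕ j) l) ⟩
      toℕ i ℕ.⊓ length l + (length l ℕ.∸ toℕ j) ≤⟨ ℕ.+-monoˡ-≤ _ (ℕ.m⊓n≤m (toℕ i) (length l)) ⟩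
      toℕ i + (length l ℕ.∸ toℕ j) <⟨ ℕ.+-monoˡ-< _ i<j ⟩
      toℕ j + (length l ℕ.∸ toℕ j) ≡⟨ ℕ.m+[n∸m]≡n (ℕ.<⇒≤ (toℕ<n j)) ⟩
      length l ∎
      where open ℕ.≤-Reasoning
    same : run (take (toℕ i) l ++ drop (toℕ j) l) f ≗ run l f
    same t = begin
      run (take (toℕ i) l ++ drop (toℕ j) l) f t ≡⟨ cong (λ g → g t) (run-++ (take (toℕ i) l) _ f) ⟩
      run (drop (toℕ j) l) (run (take (toℕ i) l) f) t ≡⟨ run-cong (drop (toℕ j) l) (encode-injective eq) t ⟩
      run (drop (toℕ j) l) (run (take (toℕ j) l) f) t ≡⟨ cong (λ g → g t) (run-++ (take (toℕ j) l) _ f) ⟨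
      run (take (toℕ j) l ++ drop (toℕ j) l) f t ≡⟨ cong (λ l′ → run l′ f t) (take++drop≡id (toℕ j) l) ⟩
      run l f t ∎
      where open ≡-Reasoning

  module _ (k : ℕ) where

    Wins : ℕ → Config n → Set
    Wins N f = ∃ λ l → length l ≤ N × weight (run l f) ≤ k

    shorten-win : ∀ f fuel l → length l ≤ fuel → weight (run l f) ≤ k → Wins (2 ^ n) f
    shorten-win f fuel l b w with length l ℕ.≤? 2 ^ n
    ... | yes p = l , p , w
    shorten-win f zero l b w | no ¬p = contradiction (ℕ.≤-trans b z≤n) ¬p
    shorten-win f (suc fuel) l b w | no ¬p with l′ , p , e ← shorten l f (ℕ.≰⇒> ¬p) =
      shorten-win f fuel l′ (ℕ.≤-pred (ℕ.≤-trans p b)) (subst (_≤ k) (≡-sym (weight-cong e)) w)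

    wins? : ∀ N f → Dec (Wins N f)
    wins? zero f = map′ (λ w → [] , z≤n , w) (λ where ([] , _ , w) → w) (weight f ℕ.≤? k)
    wins? (suc N) f = map′ to from ((weight f ℕ.≤? k) ⊎-dec any? (λ s → wins? N (κ Γ s f)))
      where
      to : (weight f ≤ k) ⊎ (∃ λ s → Wins N (κ Γ s f)) → Wins (suc N) f
      to (inj₁ w) = [] , z≤n , w
      to (inj₂ (s , l , b , w)) = s ∷ l , s≤s b , w
      from : Wins (suc N) f → (weight f ≤ k) ⊎ (∃ λ s → Wins N (κ Γ s f))
      from ([] , b , w) = inj₁ w
      from (s ∷ l , s≤s b , w) = inj₂ (s , l , b , w)

    -- The search through at most `2 ^ n` moves is decidable, and by `shorten-win` it misses no win.
    lit-stable : ∀ f → ¬ ¬ (Σ (Config n) λ g → Reach Γ f g × weight g ≤ k) → Σ (Config n) λ g → Reach Γ f g × weight g ≤ k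
    lit-stable f ¬¬win with wins? (2 ^ n) f
    ... | yes (l , _ , w) = run l f , run-Reach l f , w
    ... | no ¬w = contradiction (λ (g , r , w) → let l , e = Reach-run r in
            ¬w (shorten-win f (length l) l ℕ.≤-refl (subst (λ g → weight g ≤ k) (≡-sym e) w))) ¬¬win

xor-move : ∀ {a b c} → a xor b ≡ c → a ≡ c xor b
xor-move {a} {b} p = trans (solve 2 (λ a b → a := (a :+ b) :+ b) refl a b) (cong (_xor b) p)

xor-cong₅ : ∀ {a b c d e a′ b′ c′ d′ e′} → a ≡ a′ → b ≡ b′ → c ≡ c′ → d ≡ d′ → e ≡ e′ →
  (a xor b) xor c xor (d xor e) ≡ (a′ xor b′) xor c′ xor (d′ xor e′)
xor-cong₅ refl refl refl refl refl = refl

-- A set of three among at least six points has a complement of at least three, so neither side of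
-- the cut is small.
weight-shift-≰ : ∀ {m} (f : Vec₂ m) e → 6 ≤ m → weight f ≡ 3 → ¬ weight (λ k → f k xor e) ≤ 2
weight-shift-≰ f false 6≤m w p with s≤s (s≤s ()) ← ℕ.≤-trans (ℕ.≤-reflexive (≡-sym (trans (weight-cong (λ k → xor-identityʳ (f k))) w))) p
weight-shift-≰ f true 6≤m w p = contradiction 6≤m (ℕ.<⇒≱ (s≤s (ℕ.≤-trans (ℕ.≤-reflexive (≡-sym (weight-not f)))
  (ℕ.+-mono-≤ (ℕ.≤-reflexive w) (subst (_≤ 2) (weight-cong (λ k → xor-comm (f k) true)) p)))))

-- Systems of points whose differences pair like transpositions.

module Configurations {n : ℕ} (Γ : Graph n) (connected : Connected Γ) (nondegenerate : Nondegenerate Γ) where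

  open Form Γ
  open Orbits Γ connected nondegenerate

  private
    V : Set
    V = Vec₂ n

  -- The elements p i + p j of Δ pair like transpositions of m points, according to the parity of ∣{i , j} ∩ {k , l}∣;
  -- the triangle condition expresses this symmetrically. Only the differences of the p i matter.
  record Frame (m : ℕ) : Set where
    field
      p : Fin m → V
      edge : ∀ {i j} → i ≢ j → Δ (p i ⊕ p j)
      triangle : ∀ {i j k} → i ≢ j → j ≢ k → i ≢ k → (p i · p j) xor (p j · p k) xor (p i · p k) ≡ true

    -- An edge separates its two ends from all other points. At an end the value comes from `·-alt`,
    -- elsewhere from `triangle`; the last summand does not depend on `k` and only records which
    -- side is marked.
    edge-cut : ∀ {i j} → i ≢ j → ∀ k → (p i ⊕ p j) · p k ≡ (α i k xor α j k) xor (p i · p j xor true)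
    edge-cut {i} {j} i≢j k = trans (·-⊕ˡ refl refl) (value (i Fin.≟ k) (j Fin.≟ k))
      where
      value : Dec (i ≡ k) → Dec (j ≡ k) → (p i · p k) xor (p j · p k) ≡ (α i k xor α j k) xor (p i · p j xor true)
      value (yes refl) _ = trans (cong₂ _xor_ (·-alt (p i)) (·-sym refl))
        (trans (solve 1 (λ a → a := (con true :+ con false) :+ (a :+ con true)) refl (p i · p j))
          (≡-sym (cong (_xor (p i · p j xor true)) (cong₂ _xor_ (α-refl i) (α-≢ (i≢j ∘ ≡-sym))))))
      value (no i≢k) (yes refl) = trans (cong ((p i · p j) xor_) (·-alt (p j)))
        (trans (solve 1 (λ a → a :+ con false := (con false :+ con true) :+ (a :+ con true)) refl (p i · p j))
          (≡-sym (cong (_xor (p i · p j xor true)) (cong₂ _xor_ (α-≢ i≢j) (α-refl j)))))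
      value (no i≢k) (no j≢k) = trans (solve 3 (λ a b c → a :+ b := (c :+ (b :+ a)) :+ c) refl (p i · p k) (p j · p k) (p i · p j))
        (trans (cong (_xor (p i · p j)) (triangle i≢j j≢k i≢k))
          (trans (xor-comm true (p i · p j)) (≡-sym (cong (_xor (p i · p j xor true)) (cong₂ _xor_ (α-≢ i≢k) (α-≢ j≢k))))))

    edge-edge : ∀ {i j} → i ≢ j → ∀ k l → (p i ⊕ p j) · (p k ⊕ p l) ≡ (α i k xor α j k) xor (α i l xor α j l)
    edge-edge {i} {j} i≢j k l = trans (·-⊕ʳ (edge-cut i≢j k) (edge-cut i≢j l))
      (solve 3 (λ a b c → (a :+ c) :+ (b :+ c) := a :+ b) refl (α i k xor α j k) (α i l xor α j l) (p i · p j xor true))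

    p-injective : ∀ {i j} → p i ≗ p j → i ≡ j
    p-injective {i} {j} e with i Fin.≟ j
    ... | yes i≡j = i≡j
    ... | no i≢j = contradiction (λ t → trans (cong (_xor p j t) (e t)) (xor-same (p j t))) (Δ-nonzero (edge i≢j))

    Cut : V → Bool → Fin m → Bool
    Cut x b k = x · p k xor b

  open Frame

  -- x separates the points k with Cut x b k = true from the others; b chooses which side is counted.
  -- A cut with at least three points on either side would give a subsystem E₆.
  Thin : ∀ {m} → Frame m → Set
  Thin P = ∀ {x} → Δ x → Σ Bool λ b → weight (Cut P x b) ≤ 2

  -- Pairwise nonorthogonal elements behave like transpositions with one common point. Placing that
  -- point at `𝟘` makes the `q i` themselves the other points.
  fromClique : ∀ {m} (q : Fin m → V) → (∀ i → Δ (q i)) → (∀ {i j} → i ≢ j → q i · q j ≡ true) → Frame (suc m)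
  fromClique {m} q inΔ clique = record { p = p′ ; edge = λ {i} {j} → edge′ i j ; triangle = λ {i} {j} {k} → triangle′ i j k }
    where
    p′ : Fin (suc m) → V
    p′ zero = 𝟘
    p′ (suc i) = q i
    edge′ : ∀ i j → i ≢ j → Δ (p′ i ⊕ p′ j)
    edge′ zero zero 0≢0 = contradiction refl 0≢0
    edge′ zero (suc j) _ = inΔ j
    edge′ (suc i) zero _ = Δ-resp (λ t → ≡-sym (xor-identityʳ (q i t))) (inΔ i)
    edge′ (suc i) (suc j) i≢j = Δ-⊕ (inΔ i) (inΔ j) (clique (i≢j ∘ cong suc))
    triangle′ : ∀ i j k → i ≢ j → j ≢ k → i ≢ k → (p′ i · p′ j) xor (p′ j · p′ k) xor (p′ i · p′ k) ≡ true
    triangle′ zero zero _ 0≢0 _ _ = contradiction refl 0≢0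
    triangle′ zero (suc _) zero _ _ 0≢0 = contradiction refl 0≢0
    triangle′ (suc _) zero zero _ 0≢0 _ = contradiction refl 0≢0
    triangle′ zero (suc j) (suc k) _ j≢k _ = cong₂ _xor_ (𝟘-· (q j)) (cong₂ _xor_ (clique (j≢k ∘ cong suc)) (𝟘-· (q k)))
    triangle′ (suc i) zero (suc k) _ _ i≢k = cong₂ _xor_ (·-sym (𝟘-· (q i))) (cong₂ _xor_ (𝟘-· (q k)) (clique (i≢k ∘ cong suc)))
    triangle′ (suc i) (suc j) zero i≢j _ _ = cong₂ _xor_ (clique (i≢j ∘ cong suc)) (cong₂ _xor_ (·-sym (𝟘-· (q j))) (·-sym (𝟘-· (q i))))
    triangle′ (suc i) (suc j) (suc k) i≢j j≢k i≢k = cong₂ _xor_ (clique (i≢j ∘ cong suc)) (cong₂ _xor_ (clique (j≢k ∘ cong suc)) (clique (i≢k ∘ cong suc)))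

  remove : ∀ {m} → Fin (suc m) → Frame (suc m) → Frame m
  remove j P = record
    { p = p P ∘ punchIn j
    ; edge = λ i≢k → edge P (i≢k ∘ punchIn-injective j _ _)
    ; triangle = λ a b c → triangle P (a ∘ punchIn-injective j _ _) (b ∘ punchIn-injective j _ _) (c ∘ punchIn-injective j _ _)
    }

  remove-thin : ∀ {m} j (P : Frame (suc m)) → Thin P → Thin (remove j P)
  remove-thin j P thin {x} d with b , w ← thin d = b , ℕ.≤-trans (weight-punchIn (Cut P x b) j) w

  -- An `x` that separates only `i` meets exactly the edges through `i`, like the transposition of
  -- `i` with a point outside the frame. That point is added as `p P i ⊕ x`, so that `x` becomes its
  -- edge to `i`.
  module Extension {m : ℕ} (P : Frame m) {x : V} (dx : Δ x) (i : Fin m) (b : Bool) (cut : Cut P x b ≗ α i) where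

    private
      p′ : Fin (suc m) → V
      p′ zero = p P i ⊕ x
      p′ (suc k) = p P k

      x·pᵢ : x · p P i ≡ true xor b
      x·pᵢ = xor-move (trans (cut i) (α-refl i))

      x·pₖ : ∀ {k} → i ≢ k → x · p P k ≡ b
      x·pₖ {k} i≢k = xor-move (trans (cut k) (α-≢ i≢k))

      new-edge : ∀ k → Δ (p P i ⊕ x ⊕ p P k)
      new-edge k with i Fin.≟ k
      ... | yes refl = Δ-resp (≗-sym (⊕-cancelˡ (p P i) x)) dx
      ... | no i≢k = Δ-resp (λ t → solve 3 (λ a b c → (a :+ b) :+ c := (a :+ c) :+ b) refl (p P i t) (p P k t) (x t))
            (Δ-⊕ (edge P i≢k) dx (trans (·-⊕ˡ (·-sym x·pᵢ) (·-sym (x·pₖ i≢k))) (solve 1 (λ a → (con true :+ a) :+ a := con true) refl b)))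

      new-· : ∀ k → p′ zero · p P k ≡ (p P i · p P k) xor (x · p P k)
      new-· k = ·-⊕ˡ refl refl

      new-triangle : ∀ {j k} → j ≢ k → (p′ zero · p P j) xor (p P j · p P k) xor (p′ zero · p P k) ≡ true
      new-triangle {j} {k} j≢k = trans (cong₂ (λ a c → a xor (p P j · p P k) xor c) (new-· j) (new-· k)) (value (i Fin.≟ j) (i Fin.≟ k))
        where
        value : Dec (i ≡ j) → Dec (i ≡ k) → ((p P i · p P j) xor (x · p P j)) xor (p P j · p P k) xor ((p P i · p P k) xor (x · p P k)) ≡ true
        value (yes refl) _ = trans (xor-cong₅ {c = p P i · p P k} {p P i · p P k} (·-alt (p P i)) x·pᵢ refl refl (x·pₖ j≢k))
          (solve 2 (λ a b → (con false :+ (con true :+ b)) :+ (a :+ (a :+ b)) := con true) refl (p P i · p P k) b)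
        value (no i≢j) (yes refl) = trans (xor-cong₅ {p P i · p P j} refl (x·pₖ i≢j) (·-sym refl) (·-alt (p P i)) x·pᵢ)
          (solve 2 (λ a b → (a :+ b) :+ (a :+ (con false :+ (con true :+ b))) := con true) refl (p P i · p P j) b)
        value (no i≢j) (no i≢k) = trans (xor-cong₅ {p P i · p P j} {_} {p P j · p P k} {p P i · p P k} refl (x·pₖ i≢j) refl refl (x·pₖ i≢k))
          (trans (solve 4 (λ c d e b → (c :+ b) :+ (d :+ (e :+ b)) := c :+ (d :+ e)) refl (p P i · p P j) (p P j · p P k) (p P i · p P k) b)
            (triangle P i≢j j≢k i≢k))

    extend : Frame (suc m)
    extend = record { p = p′ ; edge = λ {i} {j} → edge′ i j ; triangle = λ {i} {j} {k} → triangle′ i j k }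
      where
      edge′ : ∀ i j → i ≢ j → Δ (p′ i ⊕ p′ j)
      edge′ zero zero 0≢0 = contradiction refl 0≢0
      edge′ zero (suc k) _ = new-edge k
      edge′ (suc k) zero _ = Δ-resp (⊕-comm (p′ zero) (p P k)) (new-edge k)
      edge′ (suc j) (suc k) j≢k = edge P (j≢k ∘ cong suc)
      triangle′ : ∀ i j k → i ≢ j → j ≢ k → i ≢ k → (p′ i · p′ j) xor (p′ j · p′ k) xor (p′ i · p′ k) ≡ true
      triangle′ zero zero _ 0≢0 _ _ = contradiction refl 0≢0
      triangle′ zero (suc _) zero _ _ 0≢0 = contradiction refl 0≢0
      triangle′ (suc _) zero zero _ 0≢0 _ = contradiction refl 0≢0
      triangle′ zero (suc j) (suc k) _ j≢k _ = new-triangle (j≢k ∘ cong suc)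
      triangle′ (suc i) zero (suc k) _ _ i≢k =
        trans (cong (_xor ((p′ zero · p P k) xor (p P i · p P k))) (·-sym refl))
          (trans (solve 3 (λ a b c → a :+ (b :+ c) := a :+ (c :+ b)) refl (p′ zero · p P i) (p′ zero · p P k) (p P i · p P k)) (new-triangle (i≢k ∘ cong suc)))
      triangle′ (suc i) (suc j) zero i≢j _ _ =
        trans (cong₂ (λ a c → (p P i · p P j) xor a xor c) (·-sym refl) (·-sym refl))
          (trans (solve 3 (λ a b c → a :+ (b :+ c) := c :+ (a :+ b)) refl (p P i · p P j) (p′ zero · p P j) (p′ zero · p P i)) (new-triangle (i≢j ∘ cong suc)))
      triangle′ (suc i) (suc j) (suc k) i≢j j≢k i≢k = triangle P (i≢j ∘ cong suc) (j≢k ∘ cong suc) (i≢k ∘ cong suc)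

    -- The side that is small for `P` remains small: if the new point falls on it, `crowded` leaves
    -- room for at most one old point there.
    extend-thin : 6 ≤ m → Thin P → Thin extend
    extend-thin 6≤m thin {y} dy = proj₁ (thin dy) , bound (proj₁ (thin dy)) (proj₂ (thin dy)) _ refl
      where
      -- If y cut off the new point and two old ones, moving y along the edge from the new point to an old one
      -- on the other side would make it cut off three old points.
      crowded : ∀ b′ → y · p′ zero xor b′ ≡ true → weight (Cut P y b′) ≢ 2
      crowded b′ new size = weight-shift-≰ (Cut P y b′ ⊕ α j) _ 6≤m (trans (weight-⊕α (Cut P y b′) j out) (cong suc size))
          (subst (_≤ 2) (weight-cong shifted) (proj₂ thin′))
        where
        gap : ∃ λ j → Cut P y b′ j ≡ false
        gap = weight<⇒false (Cut P y b′) (subst (ℕ._< m) (≡-sym size) (ℕ.≤-trans (s≤s (s≤s (s≤s z≤n))) 6≤m))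
        j : Fin m
        j = proj₁ gap
        out : Cut P y b′ j ≡ false
        out = proj₂ gap
        thin′ : Σ Bool λ b″ → weight (Cut P (y ⊕ (p′ zero ⊕ p P j)) b″) ≤ 2
        thin′ = thin (Δ-⊕ dy (new-edge j) (trans (·-⊕ʳ (xor-move new) (xor-move out)) (solve 1 (λ a → (con true :+ a) :+ a := con true) refl b′)))
        b″ : Bool
        b″ = proj₁ thin′
        shifted : Cut P (y ⊕ (p′ zero ⊕ p P j)) b″ ≗ (λ k → (Cut P y b′ ⊕ α j) k xor ((b′ xor b″) xor (p′ zero · p P j xor true)))
        shifted k = trans (cong (_xor b″) (·-⊕ˡ refl (trans (edge-cut extend {zero} {suc j} (λ ()) (suc k)) (cong (_xor (p′ zero · p P j xor true)) (α-suc j k)))))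
          (solve 5 (λ a c d e f → (a :+ (c :+ d)) :+ f := ((a :+ e) :+ c) :+ ((e :+ f) :+ d)) refl (y · p P k) (α j k) (p′ zero · p P j xor true) b′ b″)
      bound : ∀ b′ → weight (Cut P y b′) ≤ 2 → ∀ c → y · p′ zero xor b′ ≡ c → weight (Cut extend y b′) ≤ 2
      bound b′ w false new = subst (λ c → (if c then 1 else 0) + weight (Cut P y b′) ≤ 2) (≡-sym new) w
      bound b′ w true new = subst (λ c → (if c then 1 else 0) + weight (Cut P y b′) ≤ 2) (≡-sym new) (ℕ.≤∧≢⇒< w (crowded b′ new))

-- The cuts of the six points 0, u, x, x + v, y, y + w by a vector z, with a, b, c, d, e the pairings of z with u, v, w, x, y.
-- The pairs {0 , u}, {x , x + v}, {y , y + w} have differences u, v, w, and Forbidden lists the cuts into 3 + 3 points.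

data Forbidden : (a b c d e : Bool) → Set where
  all : ∀ {d e} → Forbidden true true true d e
  link-uv : ∀ {e} → Forbidden false false true true e
  link-uw : ∀ {d} → Forbidden false true false d true
  link-vw : ∀ {d e} → d xor e ≡ true → Forbidden true false false d e

hexCut : (a b c d e : Bool) → Fin 6 → Bool
hexCut a b c d e zero = false
hexCut a b c d e (suc zero) = a
hexCut a b c d e (suc (suc zero)) = d
hexCut a b c d e (suc (suc (suc zero))) = d xor b
hexCut a b c d e (suc (suc (suc (suc zero)))) = e
hexCut a b c d e (suc (suc (suc (suc (suc zero))))) = e xor c

-- A cut of six points that is not 3 + 3 has a side with at most two points; `f` selects that side.
-- The ten forbidden cases are the ten splittings into halves.
dichotomy : ∀ a b c d e → Forbidden a b c d e ⊎ Σ Bool λ f → weight (λ k → hexCut a b c d e k xor f) ≤ 2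
dichotomy true true true true true = inj₁ all
dichotomy true true true true false = inj₁ all
dichotomy true true true false true = inj₁ all
dichotomy true true true false false = inj₁ all
dichotomy true true false true true = inj₂ (true , s≤s (s≤s z≤n))
dichotomy true true false true false = inj₂ (false , s≤s (s≤s z≤n))
dichotomy true true false false true = inj₂ (true , s≤s (s≤s z≤n))
dichotomy true true false false false = inj₂ (false , s≤s (s≤s z≤n))
dichotomy true false true true true = inj₂ (true , s≤s (s≤s z≤n))
dichotomy true false true true false = inj₂ (true , s≤s (s≤s z≤n))
dichotomy true false true false true = inj₂ (false , s≤s (s≤s z≤n))
dichotomy true false true false false = inj₂ (false , s≤s (s≤s z≤n))
dichotomy true false false true true = inj₂ (true , s≤s z≤n)
dichotomy true false false true false = inj₁ (link-vw refl)
dichotomy true false false false true = inj₁ (link-vw refl)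
dichotomy true false false false false = inj₂ (false , s≤s z≤n)
dichotomy false true true true true = inj₂ (false , s≤s (s≤s z≤n))
dichotomy false true true true false = inj₂ (false , s≤s (s≤s z≤n))
dichotomy false true true false true = inj₂ (false , s≤s (s≤s z≤n))
dichotomy false true true false false = inj₂ (false , s≤s (s≤s z≤n))
dichotomy false true false true true = inj₁ link-uw
dichotomy false true false true false = inj₂ (false , s≤s z≤n)
dichotomy false true false false true = inj₁ link-uw
dichotomy false true false false false = inj₂ (false , s≤s z≤n)
dichotomy false false true true true = inj₁ link-uv
dichotomy false false true true false = inj₁ link-uv
dichotomy false false true false true = inj₂ (false , s≤s z≤n)
dichotomy false false true false false = inj₂ (false , s≤s z≤n)
dichotomy false false false true true = inj₂ (true , s≤s (s≤s z≤n))
dichotomy false false false true false = inj₂ (false , s≤s (s≤s z≤n))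
dichotomy false false false false true = inj₂ (false , s≤s (s≤s z≤n))
dichotomy false false false false false = inj₂ (false , z≤n)

-- From a bad orthogonal triple to a line graph.

module Classification {n : ℕ} (Γ : Graph n) (connected : Connected Γ) (nondegenerate : Nondegenerate Γ) where

  open Form Γ
  open Orbits Γ connected nondegenerate
  open Configurations Γ connected nondegenerate
  open Frame

  private
    V : Set
    V = Vec₂ n

  -- As edges from the point `𝟘`, `x` links the pair of `u` to that of `v`, and `y` links it to that
  -- of `w`. The hypotheses on pairings make `u`, `x`, `x ⊕ v`, `y`, `y ⊕ w` a clique.
  module Hexagon {u v w x y : V} (du : Δ u) (dv : Δ v) (dw : Δ w) (dx : Δ x) (dy : Δ y)
    (uv : u · v ≡ false) (uw : u · w ≡ false) (vw : v · w ≡ false)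
    (xu : x · u ≡ true) (xv : x · v ≡ true) (xw : x · w ≡ false)
    (yu : y · u ≡ true) (yv : y · v ≡ false) (yw : y · w ≡ true) (xy : x · y ≡ true)
    (apart : ∀ {z} → Δ z → z · u ≡ true → z · v ≡ true → z · w ≡ true → ⊥) where

    private
      q : Fin 5 → V
      q zero = u
      q (suc zero) = x
      q (suc (suc zero)) = x ⊕ v
      q (suc (suc (suc zero))) = y
      q (suc (suc (suc (suc zero)))) = y ⊕ w

      q-Δ : ∀ i → Δ (q i)
      q-Δ zero = du
      q-Δ (suc zero) = dx
      q-Δ (suc (suc zero)) = Δ-⊕ dx dv xv
      q-Δ (suc (suc (suc zero))) = dy
      q-Δ (suc (suc (suc (suc zero)))) = Δ-⊕ dy dw yw

      below : ∀ {i j} → i Fin.< j → q i · q j ≡ true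
      below {zero} {suc zero} _ = ·-sym xu
      below {zero} {suc (suc zero)} _ = ·-⊕ʳ (·-sym xu) uv
      below {zero} {suc (suc (suc zero))} _ = ·-sym yu
      below {zero} {suc (suc (suc (suc zero)))} _ = ·-⊕ʳ (·-sym yu) uw
      below {suc zero} {suc (suc zero)} _ = ·-⊕ʳ (·-alt x) xv
      below {suc zero} {suc (suc (suc zero))} _ = xy
      below {suc zero} {suc (suc (suc (suc zero)))} _ = ·-⊕ʳ xy xw
      below {suc (suc zero)} {suc (suc (suc zero))} _ = ·-⊕ˡ xy (·-sym yv)
      below {suc (suc zero)} {suc (suc (suc (suc zero)))} _ = ·-⊕ˡ (·-⊕ʳ xy xw) (·-⊕ʳ (·-sym yv) vw)
      below {suc (suc (suc zero))} {suc (suc (suc (suc zero)))} _ = ·-⊕ʳ (·-alt y) yw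
      below {suc zero} {suc zero} (s≤s ())
      below {suc (suc zero)} {suc zero} (s≤s ())
      below {suc (suc zero)} {suc (suc zero)} (s≤s (s≤s ()))
      below {suc (suc (suc zero))} {suc zero} (s≤s ())
      below {suc (suc (suc zero))} {suc (suc zero)} (s≤s (s≤s ()))
      below {suc (suc (suc zero))} {suc (suc (suc zero))} (s≤s (s≤s (s≤s ())))
      below {suc (suc (suc (suc zero)))} {suc zero} (s≤s ())
      below {suc (suc (suc (suc zero)))} {suc (suc zero)} (s≤s (s≤s ()))
      below {suc (suc (suc (suc zero)))} {suc (suc (suc zero))} (s≤s (s≤s (s≤s ())))
      below {suc (suc (suc (suc zero)))} {suc (suc (suc (suc zero)))} (s≤s (s≤s (s≤s (s≤s ()))))

      clique : ∀ {i j} → i ≢ j → q i · q j ≡ true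
      clique {i} {j} i≢j with <-cmp i j
      ... | tri< i<j _ _ = below i<j
      ... | tri≈ _ i≡j _ = contradiction i≡j i≢j
      ... | tri> _ _ j<i = ·-sym (below j<i)

    frame : Frame 6
    frame = fromClique q q-Δ clique

    private
      hexCut-· : ∀ z k → z · p frame k ≡ hexCut (z · u) (z · v) (z · w) (z · x) (z · y) k
      hexCut-· z zero = ·-sym (𝟘-· z)
      hexCut-· z (suc zero) = refl
      hexCut-· z (suc (suc zero)) = refl
      hexCut-· z (suc (suc (suc zero))) = ·-⊕ʳ refl refl
      hexCut-· z (suc (suc (suc (suc zero)))) = refl
      hexCut-· z (suc (suc (suc (suc (suc zero))))) = ·-⊕ʳ refl refl

      -- In each forbidden cut `z` itself, or its sum with `x`, `y` or `x ⊕ y`, is an element of `Δ`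
      -- meeting all of `u`, `v`, `w`, against `apart`.
      ¬forbidden : ∀ {z a b c d e} → Δ z → z · u ≡ a → z · v ≡ b → z · w ≡ c → z · x ≡ d → z · y ≡ e → ¬ Forbidden a b c d e
      ¬forbidden dz zu zv zw zx zy all = apart dz zu zv zw
      ¬forbidden dz zu zv zw zx zy link-uv = apart (Δ-⊕ dz dx zx) (·-⊕ˡ zu xu) (·-⊕ˡ zv xv) (·-⊕ˡ zw xw)
      ¬forbidden dz zu zv zw zx zy link-uw = apart (Δ-⊕ dz dy zy) (·-⊕ˡ zu yu) (·-⊕ˡ zv yv) (·-⊕ˡ zw yw)
      ¬forbidden dz zu zv zw zx zy (link-vw p) = apart (Δ-⊕ dz (Δ-⊕ dx dy xy) (trans (·-⊕ʳ zx zy) p))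
        (·-⊕ˡ zu (·-⊕ˡ xu yu)) (·-⊕ˡ zv (·-⊕ˡ xv yv)) (·-⊕ˡ zw (·-⊕ˡ xw yw))

    frame-thin : Thin frame
    frame-thin {z} dz with dichotomy (z · u) (z · v) (z · w) (z · x) (z · y)
    ... | inj₁ f = contradiction f (¬forbidden dz refl refl refl refl refl)
    ... | inj₂ (b , le) = b , subst (_≤ 2) (weight-cong (λ k → cong (_xor b) (≡-sym (hexCut-· z k)))) le

    -- Nondegeneracy is essential: in the root system E₇ modulo 2, u + v + w can span the radical,
    -- and then every cut of the six points is even.
    thin-heptad : Σ (Frame 7) Thin
    thin-heptad = build (small _ (proj₂ thinness))
      where
      s : V
      s = u ⊕ v ⊕ w
      Q-s : Q Γ s ≡ true
      Q-s = trans (Q-⊕-· (u ⊕ v) w) (cong₂ _xor_ (trans (Q-⊕-· u v) (cong₂ _xor_ (Δ-Q du) (cong₂ _xor_ (Δ-Q dv) uv))) (cong₂ _xor_ (Δ-Q dw) (·-⊕ˡ uw vw)))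
      found : ∃ λ t → s · α t ≡ true
      found = detect (λ e → true≢false (trans (≡-sym Q-s) (trans (Q-cong e) Q-𝟘)))
      z : V
      z = α (proj₁ found)
      thinness : Σ Bool λ b → weight (Cut frame z b) ≤ 2
      thinness = frame-thin (Δ-α (proj₁ found))
      b : Bool
      b = proj₁ thinness
      -- The six points add up to `s`, so the parity of the cut is `z · s`; `b` drops out because
      -- six is even. Being odd and at most two, the cut consists of a single point.
      odd : Σ₂ (Cut frame z b) ≡ true
      odd = trans (trans (Σ₂-cong {g = λ k → hexCut (z · u) (z · v) (z · w) (z · x) (z · y) k xor b} (λ k → cong (_xor b) (hexCut-· z k)))
          (solve 6 (λ a b c d e f → (con false :+ f) :+ ((a :+ f) :+ ((d :+ f) :+ (((d :+ b) :+ f) :+ ((e :+ f) :+ (((e :+ c) :+ f) :+ con false))))) := (a :+ b) :+ c) refl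
            (z · u) (z · v) (z · w) (z · x) (z · y) b))
        (trans (≡-sym (·-⊕ʳ (·-⊕ʳ refl refl) refl)) (·-sym (proj₂ found)))
      build : Small (Cut frame z b) → Σ (Frame 7) Thin
      build (none e) = contradiction (trans (≡-sym odd) (Σ₂-zero e)) true≢false
      build (one i e) = extend , extend-thin ℕ.≤-refl frame-thin
        where open Extension frame (Δ-α (proj₁ found)) i b e
      build (two i j _ e) = contradiction (trans (≡-sym odd) (trans (Σ₂-cong e) (trans (Σ₂-xor (α i) (α j)) (cong₂ _xor_ (Σ₂-α i) (Σ₂-α j))))) true≢false

  thin-frame : ∀ {u v w} → Δ u → Δ v → Δ w → u · v ≡ false → u · w ≡ false → v · w ≡ false → ¬ Δ (u ⊕ v ⊕ w) → Σ (Frame 7) Thin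
  thin-frame {u} {v} {w} du dv dw uv uw vw bad
    with x , dx , xu , xv ← common-neighbour du dv uv = go (¬-not (λ xw → apart dx xu xv xw))
    where
    -- Such a `z` would allow adding `u`, `v`, `w` to it one by one within `Δ`. The result still
    -- meets `z`, and adding `z` once more gives `u ⊕ v ⊕ w`.
    apart : ∀ {z} → Δ z → z · u ≡ true → z · v ≡ true → z · w ≡ true → ⊥
    apart {z} dz zu zv zw = bad (Δ-resp (λ t → solve 4 (λ z u v w → z :+ (((z :+ u) :+ v) :+ w) := (u :+ v) :+ w) refl (z t) (u t) (v t) (w t))
      (Δ-⊕ dz (Δ-⊕ (Δ-⊕ (Δ-⊕ dz du zu) dv (·-⊕ˡ zv uv)) dw (·-⊕ˡ (·-⊕ˡ zw uw) vw)) (·-⊕ʳ (·-⊕ʳ (·-⊕ʳ (·-alt z) zu) zv) zw)))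
    go : x · w ≡ false → Σ (Frame 7) Thin
    -- If `y` meets exactly one of `u` and `v`, the hexagon arises, up to swapping `u` and `v`. If
    -- it meets both, `y` violates `apart`; if neither, `x ⊕ y` does.
    go xw with y , dy , yx , yw ← common-neighbour dx dw xw with y · u in yu | y · v in yv
    ... | true | true = ⊥-elim (apart dy yu yv yw)
    ... | true | false = Hexagon.thin-heptad du dv dw dx dy uv uw vw xu xv xw yu yv yw (·-sym yx) apart
    ... | false | true = Hexagon.thin-heptad dv du dw dx dy (·-sym uv) vw uw xv xu xw yv yu yw (·-sym yx) (λ dz zv zu zw → apart dz zu zv zw)
    ... | false | false = ⊥-elim (apart (Δ-⊕ dx dy (·-sym yx)) (·-⊕ˡ xu yu) (·-⊕ˡ xv yv) (·-⊕ˡ xw yw))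

  -- The frame has at least seven points because `¬adjacent` removes one before extending, and
  -- `extend-thin` needs six to be left.
  module Maximal {m : ℕ} (P : Frame (suc m)) (thin : Thin P) (6≤m : 6 ≤ m)
    (maximal : (P′ : Frame (suc (suc m))) → ¬ Thin P′) where

    private
      6≤1+m : 6 ≤ suc m
      6≤1+m = ℕ.m≤n⇒m≤1+n 6≤m

    ¬one : ∀ {x b i} → Δ x → ¬ Cut P x b ≗ α i
    ¬one {x} {b} {i} dx e = maximal extend (extend-thin 6≤1+m thin)
      where open Extension P dx i b e

    -- If y cuts off {i , j} then j can be replaced by the point p i + y, which a neighbour x of y
    -- orthogonal to the frame cuts off alone.
    ¬adjacent : ∀ {x y b b′ i j} → Δ x → Δ y → x · y ≡ true → i ≢ j → Cut P x b ≗ 𝟘 → ¬ Cut P y b′ ≗ α i ⊕ α j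
    ¬adjacent {x} {y} {b} {b′} {i} {j} dx dy xy i≢j ex ey =
      maximal E₂.extend (E₂.extend-thin 6≤1+m (E₁.extend-thin 6≤m (remove-thin j P thin)))
      where
      j≢i : j ≢ i
      j≢i = i≢j ∘ ≡-sym
      i′ : Fin m
      i′ = punchOut j≢i
      cut₁ : Cut (remove j P) y b′ ≗ α i′
      cut₁ k = trans (ey (punchIn j k)) (trans (cong (α i (punchIn j k) xor_) (α-≢ (punchInᵢ≢i j k ∘ ≡-sym)))
        (trans (xor-identityʳ _) (α-punchIn j≢i k)))
      module E₁ = Extension (remove j P) dy i′ b′ cut₁
      cut₂ : Cut E₁.extend x b ≗ α zero
      cut₂ zero = trans (cong (_xor b) (·-⊕ʳ (xor-move (ex (punchIn j i′))) xy)) (solve 1 (λ b → ((con false :+ b) :+ con true) :+ b := con true) refl b)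
      cut₂ (suc k) = ex (punchIn j k)
      module E₂ = Extension E₁.extend dx zero b cut₂

    -- A common neighbour `y` of `x` and some edge cuts the frame nontrivially. Cutting off one
    -- point contradicts `¬one`, cutting off two contradicts `¬adjacent`.
    ¬none : ∀ {x b} → Δ x → ¬ Cut P x b ≗ 𝟘
    ¬none {x} {b} dx e = neighbour (common-neighbour dx (edge P {i₀} {i₁} i₀≢i₁) x·e)
      where
      i₀ i₁ : Fin (suc m)
      i₀ = zero
      i₁ = Fin.fromℕ< {1} (ℕ.≤-trans (s≤s (s≤s z≤n)) 6≤1+m)
      i₀≢i₁ : i₀ ≢ i₁
      i₀≢i₁ eq with () ← trans (cong toℕ eq) (toℕ-fromℕ< (ℕ.≤-trans (s≤s (s≤s z≤n)) 6≤1+m))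
      x·e : x · (p P i₀ ⊕ p P i₁) ≡ false
      x·e = trans (·-⊕ʳ (xor-move (e i₀)) (xor-move (e i₁))) (xor-same b)
      neighbour : ¬ CommonNeighbour x (p P i₀ ⊕ p P i₁)
      neighbour (y , dy , yx , ye) with thin dy
      ... | b′ , w with small (Cut P y b′) w
      ...   | none e′ = true≢false (trans (≡-sym ye) (trans (·-⊕ʳ (xor-move (e′ i₀)) (xor-move (e′ i₁))) (xor-same b′)))
      ...   | one _ e′ = ¬one dy e′
      ...   | two i j i≢j e′ = ¬adjacent dx dy (·-sym yx) i≢j e e′

    -- Constancy on the points expresses orthogonality to all edges.
    Residue : V → Set
    Residue r = Σ Bool λ c → ∀ k → r · p P k ≡ c

    Residue-edge : ∀ {r} → Residue r → ∀ i j → r · (p P i ⊕ p P j) ≡ false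
    Residue-edge (c , h) i j = trans (·-⊕ʳ (h i) (h j)) (xor-same c)

    record Decomposition (x : V) : Set where
      field
        {i j} : Fin (suc m)
        i≢j : i ≢ j
        r : V
        residue : Residue r
        sum : x ≗ p P i ⊕ p P j ⊕ r
    open Decomposition

    decompose : ∀ {x} → Δ x → Decomposition x
    decompose {x} dx with thin dx
    ... | b , w with small (Cut P x b) w
    ...   | none e = ⊥-elim (¬none dx e)
    ...   | one _ e = ⊥-elim (¬one dx e)
    ...   | two i j i≢j e = record
      { i≢j = i≢j
      ; r = x ⊕ (p P i ⊕ p P j)
      ; residue = b xor (p P i · p P j xor true) , λ k → trans (·-⊕ˡ (xor-move (e k)) (edge-cut P i≢j k))
          (solve 3 (λ a b c → (a :+ b) :+ (a :+ c) := b :+ c) refl (α i k xor α j k) b (p P i · p P j xor true))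
      ; sum = λ t → solve 3 (λ x a b → x := (a :+ b) :+ (x :+ (a :+ b))) refl (x t) (p P i t) (p P j t)
      }

    -- The edge from `j` to `k` shares one end with that from `i` to `j` and is orthogonal to `r`,
    -- so adding it stays in `Δ`. Two such slides give `transport`.
    slide : ∀ {r i j} → Residue r → Δ (p P i ⊕ p P j ⊕ r) → ∀ k → i ≢ j → i ≢ k → Δ (p P i ⊕ p P k ⊕ r)
    slide {r} {i} {j} res d k i≢j i≢k with j Fin.≟ k
    ... | yes refl = d
    ... | no j≢k = Δ-resp (λ t → solve 4 (λ i j k r → ((i :+ j) :+ r) :+ (j :+ k) := (i :+ k) :+ r) refl (p P i t) (p P j t) (p P k t) (r t))
      (Δ-⊕ d (edge P j≢k) (·-⊕ˡ (trans (edge-edge P i≢j j k) (cong₂ _xor_ (cong₂ _xor_ (α-≢ i≢j) (α-refl j)) (cong₂ _xor_ (α-≢ i≢k) (α-≢ j≢k)))) (Residue-edge res j k)))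

    transport : ∀ {r i j} → Residue r → i ≢ j → Δ (p P i ⊕ p P j ⊕ r) → ∀ {k l} → k ≢ l → Δ (p P k ⊕ p P l ⊕ r)
    transport {r} {i} {j} res i≢j d {k} {l} k≢l with i Fin.≟ k
    ... | yes refl = slide res d l i≢j k≢l
    ... | no i≢k = slide res (Δ-resp (⊕-cong (⊕-comm (p P i) (p P k)) (λ t → refl {x = r t})) (slide res d k i≢j i≢k)) l (i≢k ∘ ≡-sym) k≢l

    -- Otherwise move the edge of `y` onto that of `x` by `transport`. The result meets `x`, and in
    -- their sum the edges cancel, so `r X ⊕ r Y` is an element of `Δ` that cuts nothing, against
    -- `¬none`.
    residues-orthogonal : ∀ {x y} → Δ x → Δ y → (X : Decomposition x) (Y : Decomposition y) → r X · r Y ≡ false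
    residues-orthogonal {x} {y} dx dy X Y = ¬-not λ rr → ¬none {b = proj₁ (residue X) xor proj₁ (residue Y)}
      (Δ-resp (λ t → trans (cong (_xor ((a t xor b t) xor r Y t)) (sum X t)) (solve 4 (λ a b c d → ((a :+ b) :+ c) :+ ((a :+ b) :+ d) := c :+ d) refl (a t) (b t) (r X t) (r Y t)))
        (Δ-⊕ dx moved (·-respˡ (≗-sym (sum X)) (·-⊕ʳ {a = false} (·-⊕ˡ (·-alt (a ⊕ b)) (Residue-edge (residue X) (i X) (j X))) (·-⊕ˡ (·-sym (Residue-edge (residue Y) (i X) (j X))) rr)))))
      (λ k → trans (cong₂ _xor_ (·-⊕ˡ (proj₂ (residue X) k) (proj₂ (residue Y) k)) refl) (xor-same (proj₁ (residue X) xor proj₁ (residue Y))))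
      where
      a b : V
      a = p P (i X)
      b = p P (j X)
      moved : Δ (a ⊕ b ⊕ r Y)
      moved = transport (residue Y) (i≢j Y) (Δ-resp (sum Y) dy) (i≢j X)

    -- The residue is orthogonal to the edge and to the residue of each `α s`, so nondegeneracy
    -- applies.
    residue-zero : ∀ {x} → Δ x → (X : Decomposition x) → r X ≗ 𝟘
    residue-zero dx X = α-separating (λ s → let Y = decompose (Δ-α s) in
      ·-respʳ (≗-sym (sum Y)) (·-⊕ʳ (Residue-edge (residue X) (i Y) (j Y)) (residues-orthogonal dx (Δ-α s) X Y)))

    sum-edge : ∀ {x} → Δ x → (X : Decomposition x) → x ≗ p P (i X) ⊕ p P (j X)
    sum-edge dx X t = trans (sum X t) (trans (cong ((p P (i X) ⊕ p P (j X)) t xor_) (residue-zero dx X t)) (xor-identityʳ _))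

    Δ-edge : ∀ {x} → Δ x → Decomposition x → Σ (Fin (suc m) × Fin (suc m)) λ (i , j) → i Fin.< j × x ≗ p P i ⊕ p P j
    Δ-edge dx X with <-cmp (i X) (j X)
    ... | tri< i<j _ _ = (i X , j X) , i<j , sum-edge dx X
    ... | tri≈ _ i≡j _ = contradiction i≡j (i≢j X)
    ... | tri> _ _ j<i = (j X , i X) , j<i , ≗-trans (sum-edge dx X) (⊕-comm (p P (i X)) (p P (j X)))

    α-edge : ∀ s → Σ (Fin (suc m) × Fin (suc m)) λ (i , j) → i Fin.< j × α s ≗ p P i ⊕ p P j
    α-edge s = Δ-edge (Δ-α s) (decompose (Δ-α s))

    isLineGraph : IsLineGraph Γ
    isLineGraph = suc m , (λ s → proj₁ (α-edge s)) , (λ s → proj₁ (proj₂ (α-edge s))) , injective ,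
        (λ s t s≢t → adjacency s≢t (proj₁ (proj₂ (α-edge s))) (proj₁ (proj₂ (α-edge t))) (proj₂ (proj₂ (α-edge s))) (proj₂ (proj₂ (α-edge t))))
      where
      same-ends : ∀ {s t} {e e′ : V} → α s ≗ e → α t ≗ e′ → e ≗ e′ → s ≡ t
      same-ends {s} {t} es et ee = ≡-sym (α-true t s (trans (et s) (trans (≡-sym (ee s)) (trans (≡-sym (es s)) (α-refl s)))))
      injective : ∀ s t → proj₁ (α-edge s) ≡ proj₁ (α-edge t) → s ≡ t
      injective s t eq = same-ends (proj₂ (proj₂ (α-edge s))) (proj₂ (proj₂ (α-edge t))) (λ x → cong (λ (i , j) → p P i x xor p P j x) eq)
      adjacency : ∀ {s t a b c d} → s ≢ t → a Fin.< b → c Fin.< d → α s ≗ p P a ⊕ p P b → α t ≗ p P c ⊕ p P d →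
        adj Γ s t ≡ true ⇔ ShareEndpoint (a , b) (c , d)
      adjacency {s} {t} {a} {b} {c} {d} s≢t a<b c<d es et = mk⇔ to from
        where
        value : ∀ {q₁ q₂ q₃ q₄} → α a c ≡ q₁ → α b c ≡ q₂ → α a d ≡ q₃ → α b d ≡ q₄ → adj Γ s t ≡ (q₁ xor q₂) xor (q₃ xor q₄)
        value e₁ e₂ e₃ e₄ = trans (≡-sym (·-αα s t)) (·-respˡ (≗-sym es) (·-respʳ (≗-sym et)
          (trans (edge-edge P (<⇒≢ a<b) c d) (cong₂ _xor_ (cong₂ _xor_ e₁ e₂) (cong₂ _xor_ e₃ e₄)))))
        to : adj Γ s t ≡ true → ShareEndpoint (a , b) (c , d)
        to st with a Fin.≟ c | a Fin.≟ d | b Fin.≟ c | b Fin.≟ d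
        ... | yes ac | _ | _ | _ = inj₁ ac
        ... | no _ | yes ad | _ | _ = inj₂ (inj₁ ad)
        ... | no _ | no _ | yes bc | _ = inj₂ (inj₂ (inj₁ bc))
        ... | no _ | no _ | no _ | yes bd = inj₂ (inj₂ (inj₂ bd))
        ... | no ac | no ad | no bc | no bd = contradiction (trans (≡-sym st) (value (α-≢ ac) (α-≢ bc) (α-≢ ad) (α-≢ bd))) true≢false
        from : ShareEndpoint (a , b) (c , d) → adj Γ s t ≡ true
        -- Exactly one of the four coincidences may hold. Here a second shared end would make `α s`
        -- and `α t` equal; in the crossed cases below, the orderings of the ends exclude it.
        from (inj₁ refl) = value (α-refl a) (α-≢ (<⇒≢ a<b ∘ ≡-sym)) (α-≢ (<⇒≢ c<d))
          (α-≢ λ where refl → s≢t (same-ends es et (λ _ → refl)))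
        from (inj₂ (inj₁ refl)) = value (α-≢ (<⇒≢ c<d ∘ ≡-sym)) (α-≢ (<⇒≢ (ℕ.<-trans c<d a<b) ∘ ≡-sym)) (α-refl a) (α-≢ (<⇒≢ a<b ∘ ≡-sym))
        from (inj₂ (inj₂ (inj₁ refl))) = value (α-≢ (<⇒≢ a<b)) (α-refl b) (α-≢ (<⇒≢ (ℕ.<-trans a<b c<d))) (α-≢ (<⇒≢ c<d))
        from (inj₂ (inj₂ (inj₂ refl))) = value (α-≢ λ where refl → s≢t (same-ends es et (λ _ → refl)))
          (α-≢ (<⇒≢ c<d ∘ ≡-sym)) (α-≢ (<⇒≢ a<b)) (α-refl b)

  -- Different points are different vectors, because their sum is a nonzero element of `Δ`.
  frame-bound : ∀ {m} → Frame m → m ≤ 2 ^ n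
  frame-bound P = injective⇒≤ {f = encode ∘ p P} (p-injective P ∘ encode-injective)

  module _ (¬line : ¬ IsLineGraph Γ) where

    -- The recursion uses up the room below `frame-bound`: thin frames with one more point are
    -- already excluded, so `P` is maximal and `Γ` would be a line graph.
    ¬thin : ∀ fuel {m} → 6 ≤ m → 2 ^ n ℕ.< suc m + fuel → (P : Frame (suc m)) → ¬ Thin P
    ¬thin zero {m} _ big P _ = ℕ.<⇒≱ big (subst (_≤ 2 ^ n) (≡-sym (ℕ.+-identityʳ (suc m))) (frame-bound P))
    ¬thin (suc fuel) {m} 6≤m big P thin = ¬line (Maximal.isLineGraph P thin 6≤m
      (¬thin fuel (ℕ.m≤n⇒m≤1+n 6≤m) (subst (2 ^ n ℕ.<_) (ℕ.+-suc (suc m) fuel) big)))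

    orthogonal-triples-closed : OrthogonalTriplesClosed
    orthogonal-triples-closed du dv dw uv uw vw bad = ¬thin (2 ^ n) ℕ.≤-refl (ℕ.m≤n+m (suc (2 ^ n)) 6) (proj₁ heptad) (proj₂ heptad)
      where
      heptad : Σ (Frame 7) Thin
      heptad = thin-frame du dv dw uv uw vw bad

    open Transitivity orthogonal-triples-closed public using (transitive)

-- The root graph is the star with `n` edges.
complete⇒lineGraph : ∀ {n} (Γ : Graph n) → (∀ s t → s ≢ t → adj Γ s t ≡ true) → IsLineGraph Γ
complete⇒lineGraph {n} Γ complete = suc n , (λ s → zero , suc s) , (λ s → s≤s z≤n) ,
  (λ s t e → suc-injective (cong proj₂ e)) , (λ s t s≢t → mk⇔ (λ _ → inj₁ refl) (λ _ → complete s t s≢t))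

non-adjacent : ∀ {n} (Γ : Graph n) → ¬ IsLineGraph Γ → Σ (Fin n) λ s → Σ (Fin n) λ t → s ≢ t × adj Γ s t ≡ false
non-adjacent Γ ¬line with any? (λ s → any? (λ t → ¬? (s Fin.≟ t) ×-dec (adj Γ s t ≟ᵇ false)))
... | yes h = h
... | no ¬h = contradiction (complete⇒lineGraph Γ (λ s t s≢t → ¬-not (λ a → ¬h (s , t , s≢t , a)))) ¬line

-- The lit-only game in terms of orbits.

module Lit {n : ℕ} (Γ : Graph n) (connected : Connected Γ) (nondegenerate : Nondegenerate Γ) (¬line : ¬ IsLineGraph Γ) where

  open Form Γ
  open Orbits Γ connected nondegenerate
  open Classification Γ connected nondegenerate
  open Game Γ

  private
    V : Set
    V = Vec₂ n

  κ-values : ∀ {v f} s → f ≗ values v → v · α s ≡ true → κ Γ s f ≗ values (v ⊕ α s)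
  κ-values {v} {f} s e p t = trans (cong₂ (λ a b → a xor (b ∧ adj Γ s t)) (e t) (trans (e s) p)) (≡-sym (·-⊕ˡ refl (·-αα s t)))

  κ-off : ∀ {f} s → f s ≡ false → κ Γ s f ≗ f
  κ-off {f} s p t = trans (cong (λ b → f t xor (b ∧ adj Γ s t)) p) (xor-identityʳ (f t))

  ⇝-Reach : ∀ {v w f} → v ⇝ w → f ≗ values v → Σ (Config n) λ g → Reach Γ f g × g ≗ values w
  ⇝-Reach {f = f} (stop e) ef = f , done , λ t → trans (ef t) (·-respˡ (≗-sym e) refl)
  ⇝-Reach (step s p r) ef with g , rg , eg ← ⇝-Reach r (κ-values s ef p) = g , move s rg , eg

  Reach-⇝ : ∀ {v f g} → Reach Γ f g → f ≗ values v → Σ V λ w → v ⇝ w × g ≗ values w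
  Reach-⇝ {v} done ef = v , stop (λ _ → refl) , ef
  Reach-⇝ {v} (move s r) ef with v · α s in p
  ... | true with w , rw , ew ← Reach-⇝ r (κ-values s ef p) = w , step s p rw , ew
  ... | false = Reach-⇝ r (≗-trans (κ-off s (trans (ef s) p)) ef)

  nonzero : ∀ {v} s → v · α s ≡ true → ¬ v ≗ 𝟘
  nonzero s p e = true≢false (trans (≡-sym p) (·-respˡ (≗-sym e) (𝟘-· (α s))))

  ⇝-nonzero : ∀ {v w} → v ⇝ w → ¬ v ≗ 𝟘 → ¬ w ≗ 𝟘
  ⇝-nonzero (stop e) v≢0 w≡0 = v≢0 (≗-trans e w≡0)
  ⇝-nonzero (step s p r) _ = ⇝-nonzero r (nonzero s (·-⊕ˡ p (·-alt (α s))))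

  values-injective : ∀ {v w} → values v ≗ values w → v ≗ w
  values-injective {v} {w} e = ⊕-≗𝟘 (α-separating (λ s → trans (·-⊕ˡ (e s) refl) (xor-same (w · α s))))

  Lit : ℕ → Config n → Set
  Lit k f = Σ (Config n) λ g → Reach Γ f g × weight g ≤ k

  -- `transitive` gives the path only up to double negation, which `lit-stable` removes once it is
  -- turned into moves of the game.
  lit-towards : ∀ {k v f} → f ≗ values v → ¬ v ≗ 𝟘 → ∀ w → ¬ w ≗ 𝟘 → Q Γ w ≡ Q Γ v → weight (values w) ≤ k → Lit k f
  lit-towards {k} {v} {f} ef v≢0 w w≢0 q le = lit-stable k f λ ¬lit →
    transitive ¬line v≢0 w≢0 (≡-sym q) λ r → let g , rg , eg = ⇝-Reach r ef in
      ¬lit (g , rg , subst (_≤ k) (≡-sym (weight-cong eg)) le)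

  lit-zero : ∀ {k v f} → f ≗ values v → v ≗ 𝟘 → Lit k f
  lit-zero {k} {v} {f} ef v≡0 = f , done , subst (_≤ k) (≡-sym (trans (weight-cong (λ s → trans (ef s)
    (·-respˡ (≗-sym v≡0) (𝟘-· (α s))))) (weight-𝟘 n))) z≤n

  LightVector : ℕ → Bool → Set
  LightVector k q = Σ V λ w → ¬ w ≗ 𝟘 × Q Γ w ≡ q × weight (values w) ≤ k

  light⇒lit : ∀ {k} → (∀ v → ¬ v ≗ 𝟘 → LightVector k (Q Γ v)) → (k -lit) Γ
  light⇒lit {k} light f = go (≗𝟘? v)
    where
    v : V
    v = proj₁ (values-surjective f)
    ef : f ≗ values v
    ef = ≗-sym (proj₂ (values-surjective f))
    go : Dec (v ≗ 𝟘) → Lit k f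
    go (yes v≡0) = lit-zero ef v≡0
    go (no v≢0) = let w , w≢0 , q , le = light v v≢0 in lit-towards ef v≢0 w w≢0 q le

  -- Since `values (d s)` is the unit configuration at `s`, the vectors of weight one are the `d s`,
  -- and those of weight two are their sums in pairs.
  module Dual (d : Fin n → V) (dual : ∀ s t → d s · α t ≡ α s t) where

    d-nonzero : ∀ s → ¬ d s ≗ 𝟘
    d-nonzero s = nonzero s (trans (dual s s) (α-refl s))

    coordinate : ∀ v t → v · d t ≡ v t
    coordinate v t = trans (·-B v (d t)) (trans (B-expand v (d t))
      (trans (Σ₂-cong (λ s → trans (cong (v s ∧_) (trans (≡-sym (·-B (α s) (d t))) (·-sym (dual t s)))) (∧-comm (v s) (α t s)))) (Σ₂-pick t v)))

    pair-nonzero : ∀ {s t} → s ≢ t → ¬ d s ⊕ d t ≗ 𝟘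
    pair-nonzero {s} {t} s≢t = nonzero s (·-⊕ˡ (trans (dual s s) (α-refl s)) (trans (dual t s) (α-≢ (s≢t ∘ ≡-sym))))

    pair-weight : ∀ {s t} → s ≢ t → weight (values (d s ⊕ d t)) ≡ 2
    pair-weight {s} {t} s≢t = trans (weight-cong (λ k → ·-⊕ˡ (dual s k) (dual t k)))
      (trans (weight-⊕α (α s) t (α-≢ s≢t)) (cong suc (weight-α s)))

    -- The pairings with the `d k` are the coordinates, and here those of `d s` are 1 except at `s`.
    -- Hence `d s ⊕ d t` is `α s ⊕ α t`; pairing both with `α t` gives the adjacency.
    complete : (∀ {s t} → s ≢ t → d s · d t ≡ true) → ∀ s t → s ≢ t → adj Γ s t ≡ true
    complete h s t s≢t = trans (≡-sym (trans (·-⊕ˡ (·-αα s t) (·-alt (α t))) (xor-identityʳ _)))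
        (·-respˡ same (·-⊕ˡ (trans (dual s t) (α-≢ s≢t)) (trans (dual t t) (α-refl t))))
      where
      gram : ∀ s k → d s · d k ≡ true xor α s k
      gram s k with s Fin.≟ k
      ... | yes refl = ·-alt (d s)
      ... | no s≢k = h s≢k
      same : d s ⊕ d t ≗ α s ⊕ α t
      same k = trans (≡-sym (coordinate (d s ⊕ d t) k)) (trans (·-⊕ˡ (gram s k) (gram t k))
        (solve 2 (λ a b → (con true :+ a) :+ (con true :+ b) := a :+ b) refl (α s k) (α t k)))

    -- All three values of `Q` in the polarisation identity equal `not q`, hence so does their sum.
    gram-constant : ∀ q → (∀ s → Q Γ (d s) ≢ q) → (∀ {s t} → s ≢ t → Q Γ (d s ⊕ d t) ≢ q) → ∀ {s t} → s ≢ t → d s · d t ≡ not q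
    gram-constant q h₁ h₂ {s} {t} s≢t = trans
      (solve 3 (λ a b c → c := (a :+ (b :+ c)) :+ (a :+ b)) refl (Q Γ (d s)) (Q Γ (d t)) (d s · d t))
      (trans (cong₂ _xor_ (trans (≡-sym (Q-⊕-· (d s) (d t))) (¬-not (h₂ s≢t))) (cong₂ _xor_ (¬-not (h₁ s)) (¬-not (h₁ t))))
        (trans (cong (not q xor_) (xor-same (not q))) (xor-identityʳ (not q))))

    light-vector : ∀ v → ¬ v ≗ 𝟘 → LightVector 2 (Q Γ v)
    light-vector v v≢0 with any? (λ s → Q Γ (d s) ≟ᵇ Q Γ v)
    ... | yes (s , q) = d s , d-nonzero s , q , subst (_≤ 2) (≡-sym (trans (weight-cong (dual s)) (weight-α s))) (s≤s z≤n)
    ... | no h₁ with any? (λ s → any? (λ t → ¬? (s Fin.≟ t) ×-dec (Q Γ (d s ⊕ d t) ≟ᵇ Q Γ v)))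
    ...   | yes (s , t , s≢t , q) = d s ⊕ d t , pair-nonzero s≢t , q , ℕ.≤-reflexive (pair-weight s≢t)
    ...   | no h₂ = ⊥-elim (excluded (Q Γ v) (gram-constant (Q Γ v) (λ s q → h₁ (s , q)) (λ s≢t q → h₂ (_ , _ , s≢t , q))))
      where
      -- If all pairings are 1, `Γ` is complete and thus a line graph. If all are 0, `d s` is
      -- orthogonal to the whole dual basis and thus zero.
      excluded : ∀ q → ¬ (∀ {s t} → s ≢ t → d s · d t ≡ not q)
      excluded false h = ¬line (complete⇒lineGraph Γ (complete h))
      excluded true h with s , _ ← detect v≢0 = d-nonzero s (λ k → trans (≡-sym (coordinate (d s) k)) (isotropic k))
        where
        isotropic : ∀ k → d s · d k ≡ false
        isotropic k with s Fin.≟ k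
        ... | yes refl = ·-alt (d s)
        ... | no s≢k = h s≢k

    -- Moves never lead from a nonzero vector to zero, so the game from `values v` ends with exactly
    -- one vertex on, that is at some `d s`, and `Q` is invariant.
    one-lit⇒hit : (1 -lit) Γ → ∀ v → ¬ v ≗ 𝟘 → Σ (Fin n) λ s → Q Γ (d s) ≡ Q Γ v
    one-lit⇒hit lit v v≢0 with g , r , le ← lit (values v) with w , vw , ew ← Reach-⇝ {v} r (λ _ → refl)
      with small g (ℕ.m≤n⇒m≤1+n le)
    ... | none e = contradiction (values-injective (λ s → trans (≡-sym (ew s)) (trans (e s) (≡-sym (𝟘-· (α s)))))) (⇝-nonzero vw v≢0)
    ... | one s e = s , trans (Q-cong (values-injective (λ t → trans (dual s t) (trans (≡-sym (e t)) (ew t))))) (≡-sym (⇝-Q vw))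
    ... | two i j i≢j e with s≤s () ← subst (_≤ 1) (trans (weight-cong e) (trans (weight-⊕α (α i) j (α-≢ i≢j)) (cong suc (weight-α i)))) le

    one-lit⇔surjective : (1 -lit) Γ ⇔ ((Σ (Fin n) λ s → Q Γ (d s) ≡ false) × (Σ (Fin n) λ s → Q Γ (d s) ≡ true))
    one-lit⇔surjective = mk⇔ to from
      where
      to : (1 -lit) Γ → (Σ (Fin n) λ s → Q Γ (d s) ≡ false) × (Σ (Fin n) λ s → Q Γ (d s) ≡ true)
      -- For the value 0 the start is the sum of two nonadjacent unit vectors, available because a
      -- complete graph is a line graph; for the value 1 a unit vector serves.
      to lit = let s , t , s≢t , st = non-adjacent Γ ¬line
                   s₀ , q₀ = one-lit⇒hit lit (α s ⊕ α t) (λ e → true≢false (trans (≡-sym (cong₂ _xor_ (α-refl s) (α-≢ (s≢t ∘ ≡-sym)))) (e s)))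
                   s₁ , q₁ = one-lit⇒hit lit (α s) (Δ-nonzero (Δ-α s))
               in (s₀ , trans q₀ (trans (Q-⊕-· (α s) (α t)) (cong₂ _xor_ (Q-α s) (cong₂ _xor_ (Q-α t) (trans (·-αα s t) st))))) , (s₁ , trans q₁ (Q-α s))
      hit : (Σ (Fin n) λ s → Q Γ (d s) ≡ false) × (Σ (Fin n) λ s → Q Γ (d s) ≡ true) → ∀ q → Σ (Fin n) λ s → Q Γ (d s) ≡ q
      hit (h , _) false = h
      hit (_ , h) true = h
      from : (Σ (Fin n) λ s → Q Γ (d s) ≡ false) × (Σ (Fin n) λ s → Q Γ (d s) ≡ true) → (1 -lit) Γ
      from h = light⇒lit λ v _ → let s , q = hit h (Q Γ v) in
        d s , d-nonzero s , q , ℕ.≤-reflexive (trans (weight-cong (dual s)) (weight-α s))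

  two-lit : (2 -lit) Γ
  two-lit = light⇒lit (Dual.light-vector (λ s → proj₁ (values-surjective (α s))) (λ s → proj₂ (values-surjective (α s))))

theorem3p2 : ∀ {n : ℕ} (Γ : Graph n) → Connected Γ → Nondegenerate Γ → ¬ IsLineGraph Γ →
    (2 -lit) Γ
    × (∀ (d : Fin n → Vec₂ n) → IsDualBasis Γ d →
        ((1 -lit) Γ ⇔ ((Σ (Fin n) λ s → Q Γ (d s) ≡ false) × (Σ (Fin n) λ s → Q Γ (d s) ≡ true))))
theorem3p2 Γ connected nondegenerate ¬line = two-lit , λ d dual →
    Dual.one-lit⇔surjective d (λ s t → trans (Orbits.·-B Γ connected nondegenerate (d s) (α t)) (dual s t))
  where open Lit Γ connected nondegenerate ¬line
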